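{- Let $q$ be a prime power and $d$ an integer with $d>q^3-q^2+2$. Then the Hermitian polar space $\mathsf{H}(2d-1,q^2)$ has no ovoid.
   Context: $\mathsf{H}(2d-1,q^2)$ denotes the finite classical polar space of totally isotropic subspaces of a non-degenerate Hermitian form on $V(2d,q^2)$, viewed in $\mathrm{PG}(2d-1,q^2)$; it has rank $d$ and its generators are the totally isotropic subspaces of projective dimension $d-1$. An ovoid of a finite polar space is a set $\mathcal{O}$ of points such that every generator meets $\mathcal{O}$ in exactly one point. -}

module Defs where

open import Level using (0ℓ)
open import Data.Nat as ℕ using (ℕ; zero; suc)
open import Data.Fin using (Fin)
open import Data.Product using (Σ; ∃; _×_)
open import Data.Nat.Primality using (Prime)
open import Relation.Binary.PropositionalEquality using (_≡_; _≢_)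
open import Relation.Nullary using (¬_)
open import Algebra.Structures using (IsCommutativeRing)
open import Function.Bundles using (_↔_)

IsPrimePower : ℕ → Set
IsPrimePower q = Σ ℕ λ p → Σ ℕ λ k → Prime p × q ≡ p ℕ.^ suc k

record Field : Set₁ where
  infixl 6 _+_
  infixl 7 _*_
  field
    Carrier : Set
    _+_ _*_ : Carrier → Carrier → Carrier
    -_      : Carrier → Carrier
    0# 1#   : Carrier
    isCommutativeRing : IsCommutativeRing _≡_ _+_ _*_ -_ 0# 1#
    0≢1     : 0# ≢ 1#
    inv     : (x : Carrier) → x ≢ 0# → Carrier
    inv-r   : (x : Carrier) (nz : x ≢ 0#) → x * inv x nz ≡ 1#

HasOrder : Field → ℕ → Set
HasOrder F m = Field.Carrier F ↔ Fin m

-- Hermitian geometry over a field F, conjugation x ↦ x^q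
-- (for F = GF(q²) this is the involutive field automorphism).
module Hermitian (F : Field) (q : ℕ) where
  open Field F

  pow : Carrier → ℕ → Carrier
  pow x zero    = 1#
  pow x (suc n) = x * pow x n

  conj : Carrier → Carrier
  conj x = pow x q

  ∑ : (n : ℕ) → (Fin n → Carrier) → Carrier
  ∑ zero    f = 0#
  ∑ (suc n) f = f Fin.zero + ∑ n (λ i → f (Fin.suc i))

  Vec : ℕ → Set
  Vec n = Fin n → Carrier

  IsZero : {n : ℕ} → Vec n → Set
  IsZero x = ∀ i → x i ≡ 0#

  NonZero : {n : ℕ} → Vec n → Set
  NonZero x = ¬ IsZero x

  Matrix : ℕ → Set
  Matrix n = Fin n → Fin n → Carrier

  IsHermitianMatrix : {n : ℕ} → Matrix n → Set
  IsHermitianMatrix A = ∀ i j → A j i ≡ conj (A i j)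

  form : {n : ℕ} → Matrix n → Vec n → Vec n → Carrier
  form {n} A x y = ∑ n (λ i → ∑ n (λ j → x i * A i j * conj (y j)))

  IsNonDegenerate : {n : ℕ} → Matrix n → Set
  IsNonDegenerate {n} A = ∀ (x : Vec n) → (∀ y → form A x y ≡ 0#) → IsZero x

  lincomb : {n k : ℕ} → (Fin k → Carrier) → (Fin k → Vec n) → Vec n
  lincomb {n} {k} c v i = ∑ k (λ j → c j * v j i)

  LinIndep : {n k : ℕ} → (Fin k → Vec n) → Set
  LinIndep {n} {k} v = ∀ (c : Fin k → Carrier) → IsZero (lincomb c v) → ∀ j → c j ≡ 0#

  InSpan : {n k : ℕ} → Vec n → (Fin k → Vec n) → Set
  InSpan {n} {k} x v = Σ (Fin k → Carrier) λ c → ∀ i → x i ≡ lincomb c v i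

  scale : {n : ℕ} → Carrier → Vec n → Vec n
  scale c x i = c * x i

  SamePoint : {n : ℕ} → Vec n → Vec n → Set
  SamePoint x y = Σ Carrier λ c → c ≢ 0# × (∀ i → y i ≡ c * x i)

  -- A generator of H(2d-1,q²) with Gram matrix A: a basis of a totally
  -- isotropic subspace of vector dimension d in V(2d,q²).
  IsGenerator : (d : ℕ) → Matrix (d ℕ.+ d) → (Fin d → Vec (d ℕ.+ d)) → Set
  IsGenerator d A v = LinIndep v × (∀ i j → form A (v i) (v j) ≡ 0#)

  -- A set of points: a predicate on nonzero vectors invariant under
  -- nonzero scalars (a point ⟨x⟩ is in O iff O x).
  IsPointSet : {n : ℕ} → (Vec n → Set) → Set
  IsPointSet {n} O = (∀ x → O x → NonZero x)
                   × (∀ x c → c ≢ 0# → O x → O (scale c x))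

  IsOvoid : (d : ℕ) → Matrix (d ℕ.+ d) → (Vec (d ℕ.+ d) → Set) → Set
  IsOvoid d A O =
    IsPointSet O ×
    (∀ (v : Fin d → Vec (d ℕ.+ d)) → IsGenerator d A v →
       Σ (Vec (d ℕ.+ d)) λ x → InSpan x v × O x ×
         (∀ y → InSpan y v → O y → SamePoint x y))

{-# OPTIONS --safe #-}

-- Suppose O is an ovoid of H(2d−1,q²).  Two orthogonal isotropic vectors of O span the same point.
-- For a totally isotropic subspace U of dimension k < d that misses O and a point p of O in U^⊥, the
-- perpendicular space of U contains (q²)^(d−1−k) points of O not orthogonal to p: take r isotropic
-- and orthogonal to p and U, and collect the points for the q² subspaces U + ⟨r + c p⟩, which share
-- no point besides p.  So O contains (q²)^(d−1) pairwise non-orthogonal isotropic points.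
-- The (q²−1)-st powers of the entries of their Gram matrix form the matrix J − I, whose rank is at
-- most (2d)^(q²−1), since it factors through a tensor power of V(2d,q²).  For d > q³ − q² + 2 this
-- is a contradiction.

module Submission where

open import Defs
open import Algebra.Bundles using (CommutativeRing; RawRing)
import Algebra.Properties.AbelianGroup
import Algebra.Properties.CommutativeMonoid.Sum
import Algebra.Properties.CommutativeSemigroup
import Algebra.Properties.CommutativeSemiring.Binomial
import Algebra.Properties.CommutativeSemiring.Exp
import Algebra.Properties.Ring
import Algebra.Properties.Semiring.Mult
import Algebra.Properties.Semiring.Sum
import Algebra.Solver.Ring
open import Algebra.Solver.Ring.AlmostCommutativeRing
  using (fromCommutativeRing; _-Raw-AlmostCommutative⟶_)
open import Data.Fin as Fin
  using (Fin; zero; suc; combine; remQuot; _↑ˡ_; _↑ʳ_; funToFin; finToFun; fromℕ; inject₁)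
import Data.Fin.Properties as Fin
open import Data.Maybe using (Maybe; just; nothing)
open import Data.Nat as ℕ using (ℕ; zero; suc; z≤n; s≤s; _!)
open import Data.Nat.Combinatorics using (_C_; nCn≡1; nCk≡n!/k![n-k]!; k![n∸k]!∣n!)
open import Data.Nat.DivMod using (m/n*n≡m)
open import Data.Nat.Divisibility using (_∣_; divides; ∣⇒≤; m∣m*n)
open import Data.Nat.Primality using (Prime; euclidsLemma; prime⇒nonTrivial; prime⇒nonZero)
import Data.Nat.Properties as ℕ
open import Data.Nat.Solver using (module +-*-Solver)
open import Data.Product using (Σ; ∃; _×_; _,_; proj₁; proj₂; uncurry)
open import Data.Sum using (_⊎_; inj₁; inj₂)
import Data.Vec as Vec
open import Data.Vec.Functional as Vector using (_∷_)
open import Data.Vec.Functional.Properties using (lookup-++ˡ; lookup-++ʳ)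
open import Function using (_∘_; Inverse; _↔_; mk↔ₛ′)
open import Function.Construct.Composition using (_↔-∘_)
open import Function.Construct.Symmetry using (↔-sym)
open import Function.Properties.Inverse using (Inverse⇒Injection)
open import Level using (0ℓ)
open import Relation.Binary using (DecidableEquality)
open import Relation.Binary.PropositionalEquality
open import Relation.Nullary using (¬_; yes; no; contradiction; ¬?)
open import Relation.Nullary.Decidable using (via-injection; decidable-stable)

-- Linear algebra over a field

-- An ovoid has q^(2d-1) + 1 points, by double counting against the generators. Here `O` is an
-- arbitrary predicate with no decision procedure to count by, so points are constructed instead;
-- the loss of a factor of about q is harmless. For fixed q the rank bound is polynomial in d, of
-- degree q² - 1, because the exponent that turns every nonzero Gram entry into 1 does not depend on
-- d, while the number of points is exponential in d. With q = 2 the constant q³ - q² + 2 leaves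
-- nothing to spare: 4^(d-1) first exceeds (2d)³ + 1 at d = 7, since 12³ > 4⁵ but 14³ + 1 < 4⁶. From
-- q = 3 on there is room for coarse estimates.

module LinearAlgebra (F : Field) (q : ℕ) where
  open Field F public
  open Hermitian F q public
  open ≡-Reasoning

  ring : CommutativeRing 0ℓ 0ℓ
  ring = record { isCommutativeRing = isCommutativeRing }

  open CommutativeRing ring public
    using ( +-comm; +-assoc; *-comm; *-assoc; *-identityˡ; *-identityʳ; +-identityˡ; +-identityʳ
          ; -‿inverseˡ; -‿inverseʳ; zeroˡ; zeroʳ; distribˡ; distribʳ; semiring; commutativeSemiring
          ; +-commutativeMonoid; *-commutativeMonoid)
  open import Algebra.Properties.Semiring.Mult semiring public
    using (×-homo-+; ×1-homo-*; ×-assoc-*) renaming (_×_ to _·_)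
  open import Algebra.Properties.Semiring.Sum semiring
    using (sum; sum-cong-≗; ∑-distrib-+; *-distribˡ-sum; sum-replicate-zero)
    renaming (∑-comm to sum-comm)
  open import Algebra.Properties.Ring (CommutativeRing.ring ring) public
    using (-0#≈0#; -‿involutive; -‿distribˡ-*; -‿distribʳ-*; -1*x≈-x)

  -- Coefficients for the ring solver: (a , b) stands for a − b, kept reduced so that equal
  -- coefficients are identical.
  private
    reduce : ℕ → ℕ → ℕ × ℕ
    reduce (suc a) (suc b) = reduce a b
    reduce a       b       = a , b

    differences : RawRing 0ℓ 0ℓ
    differences = record
      { Carrier = ℕ × ℕ
      ; _≈_ = _≡_
      ; _+_ = λ { (a , b) (c , d) → reduce (a ℕ.+ c) (b ℕ.+ d) }
      ; _*_ = λ { (a , b) (c , d) → reduce (a ℕ.* c ℕ.+ b ℕ.* d) (a ℕ.* d ℕ.+ b ℕ.* c) }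
      ; -_ = λ { (a , b) → b , a }
      ; 0# = 0 , 0
      ; 1# = 1 , 0
      }

    ⟦_⟧ᵈ : ℕ × ℕ → Carrier
    ⟦ a , b ⟧ᵈ = a · 1# + - (b · 1#)

    open import Algebra.Properties.AbelianGroup (CommutativeRing.+-abelianGroup ring)
      using (⁻¹-∙-comm)
    open import Algebra.Properties.CommutativeSemigroup
      (CommutativeRing.+-commutativeSemigroup ring) using (interchange)

    cancel : ∀ x y z → (z + x) + - (z + y) ≡ x + - y
    cancel x y z = begin
      (z + x) + - (z + y)       ≡⟨ cong ((z + x) +_) (⁻¹-∙-comm z y) ⟨
      (z + x) + (- z + - y)     ≡⟨ interchange z x (- z) (- y) ⟩
      (z + - z) + (x + - y)     ≡⟨ cong (_+ (x + - y)) (-‿inverseʳ z) ⟩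
      0# + (x + - y)            ≡⟨ +-identityˡ _ ⟩
      x + - y                   ∎

    reduce-sound : ∀ a b → ⟦ reduce a b ⟧ᵈ ≡ ⟦ a , b ⟧ᵈ
    reduce-sound zero    b       = refl
    reduce-sound (suc a) zero    = refl
    reduce-sound (suc a) (suc b) =
      trans (reduce-sound a b) (sym (cancel (a · 1#) (b · 1#) 1#))

    homo : differences -Raw-AlmostCommutative⟶ fromCommutativeRing ring
    homo = record
      { ⟦_⟧ = ⟦_⟧ᵈ
      ; +-homo = λ { (a , b) (c , d) → begin
          ⟦ reduce (a ℕ.+ c) (b ℕ.+ d) ⟧ᵈ  ≡⟨ reduce-sound (a ℕ.+ c) (b ℕ.+ d) ⟩
          (a ℕ.+ c) · 1# + - ((b ℕ.+ d) · 1#)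
            ≡⟨ cong₂ (λ x y → x + - y) (×-homo-+ 1# a c) (×-homo-+ 1# b d) ⟩
          (a · 1# + c · 1#) + - (b · 1# + d · 1#)
            ≡⟨ cong₂ _+_ refl (⁻¹-∙-comm (b · 1#) (d · 1#)) ⟨
          (a · 1# + c · 1#) + (- (b · 1#) + - (d · 1#))
            ≡⟨ interchange _ _ _ _ ⟩
          ⟦ a , b ⟧ᵈ + ⟦ c , d ⟧ᵈ ∎ }
      ; *-homo = λ { (a , b) (c , d) → begin
          ⟦ reduce (a ℕ.* c ℕ.+ b ℕ.* d) (a ℕ.* d ℕ.+ b ℕ.* c) ⟧ᵈ
            ≡⟨ reduce-sound (a ℕ.* c ℕ.+ b ℕ.* d) (a ℕ.* d ℕ.+ b ℕ.* c) ⟩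
          (a ℕ.* c ℕ.+ b ℕ.* d) · 1# + - ((a ℕ.* d ℕ.+ b ℕ.* c) · 1#)
            ≡⟨ cong₂ (λ x y → x + - y) (bil a c b d) (bil a d b c) ⟩
          (a · 1# * c · 1# + b · 1# * d · 1#) + - (a · 1# * d · 1# + b · 1# * c · 1#)
            ≡⟨ mul (a · 1#) (b · 1#) (c · 1#) (d · 1#) ⟩
          ⟦ a , b ⟧ᵈ * ⟦ c , d ⟧ᵈ ∎ }
      ; -‿homo = λ { (a , b) → begin
          b · 1# + - (a · 1#)        ≡⟨ +-comm _ _ ⟩
          - (a · 1#) + b · 1#        ≡⟨ cong (- (a · 1#) +_) (-‿involutive _) ⟨
          - (a · 1#) + - - (b · 1#)  ≡⟨ ⁻¹-∙-comm _ _ ⟩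
          - ⟦ a , b ⟧ᵈ               ∎ }
      ; 0-homo = trans (+-identityˡ _) -0#≈0#
      ; 1-homo = trans (cong₂ _+_ (+-identityʳ 1#) -0#≈0#) (+-identityʳ 1#)
      }
      where
      bil : ∀ a c b d → (a ℕ.* c ℕ.+ b ℕ.* d) · 1# ≡ a · 1# * c · 1# + b · 1# * d · 1#
      bil a c b d = trans (×-homo-+ 1# (a ℕ.* c) (b ℕ.* d)) (cong₂ _+_ (×1-homo-* a c) (×1-homo-* b d))

      mul : ∀ x y z w → (x * z + y * w) + - (x * w + y * z) ≡ (x + - y) * (z + - w)
      mul x y z w = sym (begin
        (x + - y) * (z + - w)                            ≡⟨ distribʳ _ _ _ ⟩
        x * (z + - w) + - y * (z + - w)                  ≡⟨ cong₂ _+_ (distribˡ _ _ _) (distribˡ _ _ _) ⟩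
        (x * z + x * - w) + (- y * z + - y * - w)
          ≡⟨ cong₂ (λ s t → (x * z + s) + t) (sym (-‿distribʳ-* x w)) (+-comm _ _) ⟩
        (x * z + - (x * w)) + (- y * - w + - y * z)
          ≡⟨ cong₂ (λ s t → (x * z + - (x * w)) + (s + t)) neg² (sym (-‿distribˡ-* y z)) ⟩
        (x * z + - (x * w)) + (y * w + - (y * z))        ≡⟨ interchange _ _ _ _ ⟩
        (x * z + y * w) + (- (x * w) + - (y * z))        ≡⟨ cong₂ _+_ refl (⁻¹-∙-comm _ _) ⟩
        (x * z + y * w) + - (x * w + y * z)              ∎)
        where
        neg² : - y * - w ≡ y * w
        neg² = begin
          - y * - w    ≡⟨ -‿distribˡ-* y (- w) ⟨
          - (y * - w)  ≡⟨ cong -_ (-‿distribʳ-* y w) ⟨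
          - - (y * w)  ≡⟨ -‿involutive _ ⟩
          y * w        ∎

    coeff≟ : ∀ x y → Maybe (⟦ x ⟧ᵈ ≡ ⟦ y ⟧ᵈ)
    coeff≟ (a , b) (c , d) with a ℕ.≟ c | b ℕ.≟ d
    ... | yes refl | yes refl = just refl
    ... | _        | _        = nothing

  module Solver where
    open import Algebra.Solver.Ring differences (fromCommutativeRing ring) homo coeff≟ public

  open Solver using (solve; _:=_; _:+_; _:*_; :-_)

  private
    ∑≡sum : ∀ n f → ∑ n f ≡ sum f
    ∑≡sum zero    f = refl
    ∑≡sum (suc n) f = cong (f zero +_) (∑≡sum n (f ∘ suc))

  ∑-cong : ∀ n {f g} → (∀ i → f i ≡ g i) → ∑ n f ≡ ∑ n g
  ∑-cong n {f} {g} eq = trans (∑≡sum n f) (trans (sum-cong-≗ eq) (sym (∑≡sum n g)))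

  ∑-0 : ∀ n → ∑ n (λ _ → 0#) ≡ 0#
  ∑-0 n = trans (∑≡sum n _) (sum-replicate-zero n)

  ∑-+ : ∀ n f g → ∑ n (λ i → f i + g i) ≡ ∑ n f + ∑ n g
  ∑-+ n f g = trans (∑≡sum n _) (trans (∑-distrib-+ f g) (sym (cong₂ _+_ (∑≡sum n f) (∑≡sum n g))))

  ∑-*ˡ : ∀ n x f → ∑ n (λ i → x * f i) ≡ x * ∑ n f
  ∑-*ˡ n x f = trans (∑≡sum n _) (trans (sym (*-distribˡ-sum x f)) (cong (x *_) (sym (∑≡sum n f))))

  ∑-*ʳ : ∀ n x f → ∑ n (λ i → f i * x) ≡ ∑ n f * x
  ∑-*ʳ n x f = trans (∑-cong n λ i → *-comm (f i) x) (trans (∑-*ˡ n x f) (*-comm x _))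

  ∑-comm : ∀ m n (f : Fin m → Fin n → Carrier) → ∑ m (λ i → ∑ n (f i)) ≡ ∑ n (λ j → ∑ m (λ i → f i j))
  ∑-comm m n f = begin
    ∑ m (λ i → ∑ n (f i))            ≡⟨ ∑∑ m n f ⟩
    sum (λ i → sum (f i))            ≡⟨ sum-comm f ⟩
    sum (λ j → sum (λ i → f i j))    ≡⟨ ∑∑ n m (λ j i → f i j) ⟨
    ∑ n (λ j → ∑ m (λ i → f i j))    ∎
    where
    ∑∑ : ∀ m n (g : Fin m → Fin n → Carrier) → ∑ m (λ i → ∑ n (g i)) ≡ sum (λ i → sum (g i))
    ∑∑ m n g = trans (∑-cong m λ i → ∑≡sum n (g i)) (∑≡sum m (λ i → sum (g i)))

  ∑-↑ : ∀ m n (f : Fin (m ℕ.+ n) → Carrier) → ∑ (m ℕ.+ n) f ≡ ∑ m (f ∘ (_↑ˡ n)) + ∑ n (f ∘ (m ↑ʳ_))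
  ∑-↑ zero    n f = sym (+-identityˡ _)
  ∑-↑ (suc m) n f = trans (cong (f zero +_) (∑-↑ m n (f ∘ suc))) (sym (+-assoc _ _ _))

  ∑-combine : ∀ m n (f : Fin (m ℕ.* n) → Carrier) → ∑ (m ℕ.* n) f ≡ ∑ m (λ i → ∑ n (λ j → f (combine i j)))
  ∑-combine zero    n f = refl
  ∑-combine (suc m) n f = trans (∑-↑ n (m ℕ.* n) f) (cong₂ _+_ refl (∑-combine m n (f ∘ (n ↑ʳ_))))

  -- Recursive in both indices, to match the recursion of `∑`. The row `δ j` also serves as the
  -- `j`-th standard basis vector.
  δ : ∀ {k} → Fin k → Fin k → Carrier
  δ zero    zero    = 1#
  δ zero    (suc j) = 0#
  δ (suc i) zero    = 0#
  δ (suc i) (suc j) = δ i j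

  ∑-δ : ∀ {k} (c : Fin k → Carrier) i → ∑ k (λ j → c j * δ i j) ≡ c i
  ∑-δ {suc k} c zero = begin
    c zero * 1# + ∑ k (λ j → c (suc j) * 0#)  ≡⟨ cong₂ _+_ (*-identityʳ _) (trans (∑-cong k (λ j → zeroʳ _)) (∑-0 k)) ⟩
    c zero + 0#                               ≡⟨ +-identityʳ _ ⟩
    c zero                                    ∎
  ∑-δ {suc k} c (suc i) = trans (cong₂ _+_ (zeroʳ _) (∑-δ (c ∘ suc) i)) (+-identityˡ _)

  δ-sym : ∀ {k} (i j : Fin k) → δ i j ≡ δ j i
  δ-sym zero    zero    = refl
  δ-sym zero    (suc j) = refl
  δ-sym (suc i) zero    = refl
  δ-sym (suc i) (suc j) = δ-sym i j

  δ-diag : ∀ {k} (i : Fin k) → δ i i ≡ 1#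
  δ-diag zero    = refl
  δ-diag (suc i) = δ-diag i

  δ-off : ∀ {k} {i j : Fin k} → i ≢ j → δ i j ≡ 0#
  δ-off {i = zero}  {zero}  i≢j = contradiction refl i≢j
  δ-off {i = zero}  {suc j} i≢j = refl
  δ-off {i = suc i} {zero}  i≢j = refl
  δ-off {i = suc i} {suc j} i≢j = δ-off (i≢j ∘ cong suc)

  infixl 6 _+ᵛ_
  _+ᵛ_ : ∀ {n} → Vec n → Vec n → Vec n
  (x +ᵛ y) i = x i + y i

  opaque
    -- Opaque, so that goals keep `dot x y` in place of sums; only `RankBound` unfolds it again, for
    -- tensor products.
    dot : ∀ {n} → Vec n → Vec n → Carrier
    dot {n} x y = ∑ n (λ i → x i * y i)

    dot-∑ : ∀ {n} (x y : Vec n) → dot x y ≡ ∑ n (λ i → x i * y i)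
    dot-∑ x y = refl

    dot-congˡ : ∀ {n} {x y : Vec n} z → (∀ i → x i ≡ y i) → dot x z ≡ dot y z
    dot-congˡ {n} z eq = ∑-cong n λ i → cong (_* z i) (eq i)

    dot-comm : ∀ {n} (x y : Vec n) → dot x y ≡ dot y x
    dot-comm {n} x y = ∑-cong n λ i → *-comm (x i) (y i)

    dot-+ˡ : ∀ {n} (x y z : Vec n) → dot (x +ᵛ y) z ≡ dot x z + dot y z
    dot-+ˡ {n} x y z = trans (∑-cong n λ i → distribʳ (z i) (x i) (y i))
                             (∑-+ n (λ i → x i * z i) (λ i → y i * z i))

    dot-scaleˡ : ∀ {n} c (x z : Vec n) → dot (scale c x) z ≡ c * dot x z
    dot-scaleˡ {n} c x z = trans (∑-cong n λ i → *-assoc c (x i) (z i)) (∑-*ˡ n c (λ i → x i * z i))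

    dot-lincombˡ : ∀ {n k} (c : Fin k → Carrier) (v : Fin k → Vec n) z →
      dot (lincomb c v) z ≡ ∑ k (λ j → c j * dot (v j) z)
    dot-lincombˡ {n} {k} c v z = begin
      ∑ n (λ i → ∑ k (λ j → c j * v j i) * z i)
        ≡⟨ ∑-cong n (λ i → sym (∑-*ʳ k (z i) (λ j → c j * v j i))) ⟩
      ∑ n (λ i → ∑ k (λ j → c j * v j i * z i))    ≡⟨ ∑-comm n k (λ i j → c j * v j i * z i) ⟩
      ∑ k (λ j → ∑ n (λ i → c j * v j i * z i))    ≡⟨ ∑-cong k (λ j → dot-scaleˡ (c j) (v j) z) ⟩
      ∑ k (λ j → c j * ∑ n (λ i → v j i * z i))    ∎

    dot-0ˡ : ∀ {n} {x : Vec n} → IsZero x → ∀ z → dot x z ≡ 0#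
    dot-0ˡ {n} x≡0 z = trans (∑-cong n λ i → trans (cong (_* z i) (x≡0 i)) (zeroˡ _)) (∑-0 n)

    dot-δ : ∀ {n} (x : Vec n) j → dot x (δ j) ≡ x j
    dot-δ x j = ∑-δ x j

  dot-congʳ : ∀ {n} {x y : Vec n} z → (∀ i → x i ≡ y i) → dot z x ≡ dot z y
  dot-congʳ z eq = trans (dot-comm z _) (trans (dot-congˡ z eq) (dot-comm _ z))

  dot-+ʳ : ∀ {n} (z x y : Vec n) → dot z (x +ᵛ y) ≡ dot z x + dot z y
  dot-+ʳ z x y = trans (dot-comm z _) (trans (dot-+ˡ x y z) (cong₂ _+_ (dot-comm x z) (dot-comm y z)))

  dot-scaleʳ : ∀ {n} c (z x : Vec n) → dot z (scale c x) ≡ c * dot z x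
  dot-scaleʳ c z x = trans (dot-comm z _) (trans (dot-scaleˡ c x z) (cong (c *_) (dot-comm x z)))

  dot-0ʳ : ∀ {n} {x : Vec n} → IsZero x → ∀ z → dot z x ≡ 0#
  dot-0ʳ x≡0 z = trans (dot-comm z _) (dot-0ˡ x≡0 z)

  dot-lincombʳ : ∀ {n k} (c : Fin k → Carrier) (v : Fin k → Vec n) z →
    dot z (lincomb c v) ≡ ∑ k (λ j → c j * dot z (v j))
  dot-lincombʳ {k = k} c v z = trans (dot-comm z _)
    (trans (dot-lincombˡ c v z) (∑-cong k λ j → cong (c j *_) (dot-comm (v j) z)))

  lincomb-0∷ : ∀ {n k} (y : Vec n) (u : Fin k → Vec n) c {a} → a ≡ 0# →
    ∀ i → lincomb (a ∷ c) (y ∷ u) i ≡ lincomb c u i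
  lincomb-0∷ {k = k} y u c {a} a≡0 i = begin
    a * y i + ∑ k (λ j → c j * u j i)  ≡⟨ cong (_+ ∑ k (λ j → c j * u j i)) (trans (cong (_* y i) a≡0) (zeroˡ _)) ⟩
    0# + ∑ k (λ j → c j * u j i)       ≡⟨ +-identityˡ _ ⟩
    ∑ k (λ j → c j * u j i)            ∎

  span-tail : ∀ {n k} {x : Vec n} (y : Vec n) (u : Fin k → Vec n) → InSpan x u → InSpan x (y ∷ u)
  span-tail y u (c , eq) = (0# ∷ c) , λ i → trans (eq i) (sym (lincomb-0∷ y u c refl i))

  span-head : ∀ {n k} (y : Vec n) (u : Fin k → Vec n) → InSpan y (y ∷ u)
  span-head {k = k} y u = (1# ∷ λ _ → 0#) , λ i → sym (begin
    1# * y i + ∑ k (λ j → 0# * u j i)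
      ≡⟨ cong₂ _+_ (*-identityˡ _) (trans (∑-cong k (λ j → zeroˡ (u j i))) (∑-0 k)) ⟩
    y i + 0#                           ≡⟨ +-identityʳ _ ⟩
    y i                                ∎)

  -- Dual covectors stand in for row reduction: they prove independence and compute coordinates.
  Dual : ∀ {n k} (u g : Fin k → Vec n) → Set
  Dual u g = ∀ i j → dot (u i) (g j) ≡ δ i j

  dual-coefficient : ∀ {n k} (u g : Fin k → Vec n) → Dual u g →
    ∀ c j → dot (lincomb c u) (g j) ≡ c j
  dual-coefficient {k = k} u g dual c j = begin
    dot (lincomb c u) (g j)             ≡⟨ dot-lincombˡ c u (g j) ⟩
    ∑ k (λ i → c i * dot (u i) (g j))   ≡⟨ ∑-cong k (λ i → cong (c i *_) (trans (dual i j) (δ-sym i j))) ⟩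
    ∑ k (λ i → c i * δ j i)             ≡⟨ ∑-δ c j ⟩
    c j                                 ∎

  dual⇒LinIndep : ∀ {n k} (u g : Fin k → Vec n) → Dual u g → LinIndep u
  dual⇒LinIndep u g dual c z j = trans (sym (dual-coefficient u g dual c j)) (dot-0ˡ z (g j))

  LinIndep-tail : ∀ {n k} (u : Fin (suc k) → Vec n) → LinIndep u → LinIndep (u ∘ suc)
  LinIndep-tail u ind c z j = ind (0# ∷ c)
    (λ i → trans (lincomb-0∷ (u zero) (u ∘ suc) c refl i) (z i)) (suc j)

  *-cancel : ∀ {x y} → x ≢ 0# → x * y ≡ 0# → y ≡ 0#
  *-cancel {x} {y} x≢0 xy≡0 = begin
    y                  ≡⟨ *-identityˡ y ⟨
    1# * y             ≡⟨ cong (_* y) (inv-r x x≢0) ⟨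
    x * inv x x≢0 * y  ≡⟨ solve 3 (λ x i y → x :* i :* y := i :* (x :* y)) refl x (inv x x≢0) y ⟩
    inv x x≢0 * (x * y)  ≡⟨ cong (inv x x≢0 *_) xy≡0 ⟩
    inv x x≢0 * 0#       ≡⟨ zeroʳ _ ⟩
    0#                 ∎

  *-nonzero : ∀ {x y} → x ≢ 0# → y ≢ 0# → x * y ≢ 0#
  *-nonzero x≢0 y≢0 xy≡0 = y≢0 (*-cancel x≢0 xy≡0)

  -≡0 : ∀ {x y} → x + - y ≡ 0# → x ≡ y
  -≡0 {x} {y} eq = begin
    x              ≡⟨ solve 2 (λ x y → x := (x :+ :- y) :+ y) refl x y ⟩
    (x + - y) + y  ≡⟨ cong (_+ y) eq ⟩
    0# + y         ≡⟨ +-identityˡ y ⟩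
    y              ∎

-- Finite fields

prime∤! : ∀ {p} k → Prime p → k ℕ.< p → ¬ p ∣ k !
prime∤! {p} zero    pr k<p p∣1 = ℕ.<⇒≱ (ℕ.nonTrivial⇒n>1 p {{prime⇒nonTrivial pr}}) (∣⇒≤ p∣1)
prime∤! (suc k) pr k<p p∣ with euclidsLemma (suc k) (k !) pr p∣
... | inj₁ p∣k = ℕ.<⇒≱ k<p (∣⇒≤ p∣k)
... | inj₂ p∣k! = prime∤! k pr (ℕ.<-trans (ℕ.n<1+n k) k<p) p∣k!

-- `p` divides `p !`, which is the binomial coefficient times two factorials of smaller numbers, and
-- it divides neither of these.
prime∣C : ∀ {p k} → Prime p → 0 ℕ.< k → k ℕ.< p → p ∣ p C k
prime∣C {suc p} {suc k} pr _ k<p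
  with euclidsLemma (suc p C suc k) (suc k ! ℕ.* (p ℕ.∸ k) !) pr
         (subst (suc p ∣_) (sym C*≡!) (m∣m*n (p !)))
  where
  instance
    _ = (suc k ℕ.!* (p ℕ.∸ k) !≢0)
  C*≡! : (suc p C suc k) ℕ.* (suc k ! ℕ.* (p ℕ.∸ k) !) ≡ suc p !
  C*≡! = trans (cong (ℕ._* (suc k ! ℕ.* (p ℕ.∸ k) !)) (nCk≡n!/k![n-k]! (ℕ.<⇒≤ k<p)))
               (m/n*n≡m (k![n∸k]!∣n! (ℕ.<⇒≤ k<p)))
... | inj₁ p∣C = p∣C
... | inj₂ p∣! with euclidsLemma (suc k !) ((p ℕ.∸ k) !) pr p∣!
... | inj₁ p∣k! = contradiction p∣k! (prime∤! (suc k) pr k<p)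
... | inj₂ p∣j! = contradiction p∣j! (prime∤! (p ℕ.∸ k) pr (s≤s (ℕ.m∸n≤m p k)))

funToFin-cong : ∀ {m n} {f g : Fin m → Fin n} → (∀ i → f i ≡ g i) → funToFin f ≡ funToFin g
funToFin-cong {zero}  eq = refl
funToFin-cong {suc m} eq = cong₂ combine (eq zero) (funToFin-cong (eq ∘ suc))

module FiniteField (F : Field) (q s : ℕ) (order : HasOrder F s) where
  open LinearAlgebra F q public
  open Solver using (solve; _:=_; _:+_; _:*_; :-_)
  open ≡-Reasoning
  open Inverse order using (strictlyInverseˡ; strictlyInverseʳ) renaming (to to index; from to element)

  _≟_ : DecidableEquality Carrier
  _≟_ = via-injection (Inverse⇒Injection order) Fin._≟_

  element-injective : ∀ {i j} → element i ≡ element j → i ≡ j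
  element-injective {i} {j} eq = trans (sym (strictlyInverseˡ i)) (trans (cong index eq) (strictlyInverseˡ j))

  index-injective : ∀ {x y} → index x ≡ index y → x ≡ y
  index-injective {x} {y} eq = trans (sym (strictlyInverseʳ x)) (trans (cong element eq) (strictlyInverseʳ y))

  isZero? : ∀ {n} (x : Vec n) → IsZero x ⊎ ∃ λ j → x j ≢ 0#
  isZero? x with Fin.all? (λ i → x i ≟ 0#)
  ... | yes x≡0 = inj₁ x≡0
  ... | no  x≢0 = inj₂ (Fin.¬∀⟶∃¬ _ _ (λ i → x i ≟ 0#) x≢0)

  opaque
    -- Pigeonhole in place of elimination: `s ^ n` vectors have only `s ^ m` tuples of values under
    -- `l`, so two of them agree, and their difference is a solution.
    kernel : ∀ {m n} → m ℕ.< n → (l : Fin m → Vec n) → Σ (Vec n) λ x → NonZero x × ∀ i → dot x (l i) ≡ 0#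
    kernel {m} {n} m<n l = difference
      where
      vec : Fin (s ℕ.^ n) → Vec n
      vec t i = element (finToFun t i)

      1<s : 1 ℕ.< s
      1<s = Fin.injective⇒≤ {f = λ i → index ((0# ∷ 1# ∷ λ ()) i)} λ
        { {zero} {zero} _ → refl
        ; {zero} {suc zero} eq → contradiction (index-injective eq) 0≢1
        ; {suc zero} {zero} eq → contradiction (sym (index-injective eq)) 0≢1
        ; {suc zero} {suc zero} _ → refl }

      values : Fin (s ℕ.^ n) → Fin (s ℕ.^ m)
      values t = funToFin (λ i → index (dot (vec t) (l i)))

      difference : Σ (Vec n) λ x → NonZero x × ∀ i → dot x (l i) ≡ 0#
      difference with Fin.pigeonhole (ℕ.^-monoʳ-< s 1<s m<n) values
      ... | t , t′ , t<t′ , eq = w , nonzero , λ i → begin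
        dot w (l i)                                         ≡⟨ dot-+ˡ (vec t) _ (l i) ⟩
        dot (vec t) (l i) + dot (scale (- 1#) (vec t′)) (l i)
          ≡⟨ cong₂ _+_ (same i) (trans (dot-scaleˡ (- 1#) (vec t′) (l i)) (-1*x≈-x _)) ⟩
        dot (vec t′) (l i) + - dot (vec t′) (l i)           ≡⟨ -‿inverseʳ _ ⟩
        0#                                                  ∎
        where
        w : Vec n
        w = vec t +ᵛ scale (- 1#) (vec t′)
        same : ∀ i → dot (vec t) (l i) ≡ dot (vec t′) (l i)
        same i = index-injective (begin
          index (dot (vec t) (l i))   ≡⟨ Fin.finToFun-funToFin (λ j → index (dot (vec t) (l j))) i ⟨
          finToFun (values t) i       ≡⟨ cong (λ z → finToFun z i) eq ⟩
          finToFun (values t′) i      ≡⟨ Fin.finToFun-funToFin (λ j → index (dot (vec t′) (l j))) i ⟩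
          index (dot (vec t′) (l i))  ∎)
        nonzero : NonZero w
        nonzero w≡0 = Fin.<⇒≢ t<t′ (begin
          t                               ≡⟨ Fin.funToFin-finToFin {n} t ⟨
          funToFin (finToFun {s} {n} t)   ≡⟨ funToFin-cong (λ i → element-injective
                                               (-≡0 (trans (cong (vec t i +_) (sym (-1*x≈-x _))) (w≡0 i)))) ⟩
          funToFin (finToFun {s} {n} t′)  ≡⟨ Fin.funToFin-finToFin {n} t′ ⟩
          t′                              ∎)

  opaque
    -- Subtracting the combination of `u` with coefficients `dot x (g i)` is a projection that kills
    -- `u`. Either it kills `p`, or some coordinate `j` of the projected `p` is nonzero; `ψ` is the
    -- covector that takes `x` to the `j`-th coordinate of its projection.
    dual-extend : ∀ {n k} (u g : Fin k → Vec n) → Dual u g → (p : Vec n) →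
      InSpan p u ⊎ Σ (Fin (suc k) → Vec n) (Dual (p ∷ u))
    dual-extend {n} {k} u g dual p with isZero? (p +ᵛ scale (- 1#) (lincomb (λ i → dot p (g i)) u))
    ... | inj₁ z = inj₁ ((λ i → dot p (g i)) , λ j →
          -≡0 (trans (cong (p j +_) (sym (-1*x≈-x _))) (z j)))
    ... | inj₂ (j , w≢0) = inj₂ (g′ , dual′)
      where
      w : Carrier
      w = p j + - 1# * lincomb (λ i → dot p (g i)) u j
      ψ φ : Vec n
      ψ = δ j +ᵛ scale (- 1#) (lincomb (λ i → u i j) g)
      φ = scale (inv w w≢0) ψ
      g′ : Fin (suc k) → Vec n
      -- The correction makes the old covectors vanish at `p`; as `φ` kills `u`, they stay dual to
      -- `u`.
      g′ = φ ∷ λ i → g i +ᵛ scale (- dot p (g i)) φ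

      dot-ψ : ∀ x → dot x ψ ≡ x j + - 1# * lincomb (λ i → dot x (g i)) u j
      dot-ψ x = begin
        dot x ψ    ≡⟨ dot-+ʳ x (δ j) _ ⟩
        dot x (δ j) + dot x (scale (- 1#) (lincomb (λ i → u i j) g))
          ≡⟨ cong₂ _+_ (dot-δ x j) (dot-scaleʳ (- 1#) x _) ⟩
        x j + - 1# * dot x (lincomb (λ i → u i j) g)
          ≡⟨ cong (λ z → x j + - 1# * z) (dot-lincombʳ (λ i → u i j) g x) ⟩
        x j + - 1# * ∑ k (λ i → u i j * dot x (g i))
          ≡⟨ cong (λ z → x j + - 1# * z) (∑-cong k λ i → *-comm (u i j) (dot x (g i))) ⟩
        x j + - 1# * lincomb (λ i → dot x (g i)) u j ∎

      pφ : dot p φ ≡ 1#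
      pφ = begin
        dot p φ                ≡⟨ dot-scaleʳ _ p ψ ⟩
        inv w w≢0 * dot p ψ    ≡⟨ cong (inv w w≢0 *_) (dot-ψ p) ⟩
        inv w w≢0 * w          ≡⟨ *-comm _ _ ⟩
        w * inv w w≢0          ≡⟨ inv-r w w≢0 ⟩
        1#                     ∎

      uφ : ∀ i → dot (u i) φ ≡ 0#
      uφ i = begin
        dot (u i) φ                ≡⟨ dot-scaleʳ _ (u i) ψ ⟩
        inv w w≢0 * dot (u i) ψ    ≡⟨ cong (inv w w≢0 *_) (dot-ψ (u i)) ⟩
        inv w w≢0 * (u i j + - 1# * ∑ k (λ l → dot (u i) (g l) * u l j))
          ≡⟨ cong (λ z → inv w w≢0 * (u i j + - 1# * z)) (trans
               (∑-cong k λ l → trans (cong (_* u l j) (dual i l)) (*-comm (δ i l) (u l j))) (∑-δ (λ l → u l j) i)) ⟩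
        inv w w≢0 * (u i j + - 1# * u i j)
          ≡⟨ cong (λ z → inv w w≢0 * (u i j + z)) (-1*x≈-x (u i j)) ⟩
        inv w w≢0 * (u i j + - u i j)   ≡⟨ cong (inv w w≢0 *_) (-‿inverseʳ _) ⟩
        inv w w≢0 * 0#                  ≡⟨ zeroʳ _ ⟩
        0#                         ∎

      g′-suc : ∀ x i {a b} → dot x (g i) ≡ a → dot x φ ≡ b → dot x (g′ (suc i)) ≡ a + - dot p (g i) * b
      g′-suc x i refl refl = trans (dot-+ʳ x (g i) _) (cong (dot x (g i) +_) (dot-scaleʳ _ x φ))

      dual′ : Dual (p ∷ u) g′
      dual′ zero    zero    = pφ
      dual′ (suc i) zero    = uφ i
      dual′ zero    (suc l) = trans (g′-suc p l refl pφ) (trans (cong (dot p (g l) +_) (*-identityʳ _)) (-‿inverseʳ _))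
      dual′ (suc i) (suc l) = trans (g′-suc (u i) l (dual i l) (uφ i)) (trans (cong (δ i l +_) (zeroʳ _)) (+-identityʳ _))

  opaque
    dual-basis : ∀ {n k} (u : Fin k → Vec n) → LinIndep u → Σ (Fin k → Vec n) (Dual u)
    dual-basis {k = zero}  u ind = (λ ()) , λ ()
    dual-basis {n} {suc k} u ind with dual-basis (u ∘ suc) (LinIndep-tail u ind)
    ... | g , dual with dual-extend (u ∘ suc) g dual (u zero)
    ... | inj₂ (g′ , dual′) = g′ , λ { zero j → dual′ zero j ; (suc i) j → dual′ (suc i) j }
    ... | inj₁ (c , eq) = contradiction (begin
      0#      ≡⟨ -0#≈0# ⟨
      - 0#    ≡⟨ cong -_ (ind (- 1# ∷ c) dependent zero) ⟨
      - - 1#  ≡⟨ -‿involutive 1# ⟩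
      1#      ∎) 0≢1
      where
      dependent : IsZero (lincomb (- 1# ∷ c) u)
      dependent i = begin
        - 1# * u zero i + lincomb c (u ∘ suc) i  ≡⟨ cong₂ _+_ (-1*x≈-x _) (sym (eq i)) ⟩
        - u zero i + u zero i                    ≡⟨ -‿inverseˡ _ ⟩
        0#                                       ∎

-- Power maps and roots of polynomials over a finite field

module Powers (F : Field) (q s : ℕ) (order : HasOrder F s) where
  open FiniteField F q s order public
  open Solver using (solve; _:=_; _:+_; _:*_; :-_)
  open ≡-Reasoning
  open Inverse order using (strictlyInverseˡ; strictlyInverseʳ) renaming (to to index; from to element)
  private
    module Sum = Algebra.Properties.CommutativeMonoid.Sum +-commutativeMonoid
    module Prod = Algebra.Properties.CommutativeMonoid.Sum *-commutativeMonoid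

  pow-1 : ∀ n → pow 1# n ≡ 1#
  pow-1 zero    = refl
  pow-1 (suc n) = trans (*-identityˡ _) (pow-1 n)

  pow-+ : ∀ x m n → pow x (m ℕ.+ n) ≡ pow x m * pow x n
  pow-+ x zero    n = sym (*-identityˡ _)
  pow-+ x (suc m) n = trans (cong (x *_) (pow-+ x m n)) (sym (*-assoc _ _ _))

  pow-distrib : ∀ x y n → pow (x * y) n ≡ pow x n * pow y n
  pow-distrib x y zero    = sym (*-identityˡ _)
  pow-distrib x y (suc n) = trans (cong (x * y *_) (pow-distrib x y n))
    (solve 4 (λ x y a b → x :* y :* (a :* b) := x :* a :* (y :* b)) refl x y (pow x n) (pow y n))

  pow-* : ∀ x m n → pow x (m ℕ.* n) ≡ pow (pow x n) m
  pow-* x zero    n = refl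
  pow-* x (suc m) n = trans (pow-+ x n (m ℕ.* n)) (cong (pow x n *_) (pow-* x m n))

  pow≡0 : ∀ x n → pow x n ≡ 0# → x ≡ 0#
  pow≡0 x zero    eq = contradiction (sym eq) 0≢1
  pow≡0 x (suc n) eq with x ≟ 0#
  ... | yes x≡0 = x≡0
  ... | no  x≢0 = pow≡0 x n (*-cancel x≢0 eq)

  1≢0 : 1# ≢ 0#
  1≢0 = 0≢1 ∘ sym

  *-cancelˡ : ∀ x {y z} → x ≢ 0# → x * y ≡ x * z → y ≡ z
  *-cancelˡ x {y} {z} x≢0 eq = -≡0 (*-cancel x≢0 (begin
    x * (y + - z)      ≡⟨ solve 3 (λ x y z → x :* (y :+ :- z) := x :* y :+ :- (x :* z)) refl x y z ⟩
    x * y + - (x * z)  ≡⟨ cong (_+ - (x * z)) eq ⟩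
    x * z + - (x * z)  ≡⟨ -‿inverseʳ _ ⟩
    0#                 ∎))

  permutation : Carrier ↔ Carrier → Fin s ↔ Fin s
  permutation π = order ↔-∘ (π ↔-∘ ↔-sym order)

  translation : Carrier → Carrier ↔ Carrier
  translation a = mk↔ₛ′ (_+ a) (_+ - a)
    (solve 2 (λ a x → (x :+ :- a) :+ a := x) refl a)
    (solve 2 (λ a x → (x :+ a) :+ :- a := x) refl a)

  dilation : ∀ {a} → a ≢ 0# → Carrier ↔ Carrier
  dilation {a} a≢0 = mk↔ₛ′ (a *_) (inv a a≢0 *_)
    (λ x → trans (solve 3 (λ a b x → a :* (b :* x) := a :* b :* x) refl a (inv a a≢0) x) (unit x))
    (λ x → trans (solve 3 (λ a b x → b :* (a :* x) := a :* b :* x) refl a (inv a a≢0) x) (unit x))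
    where
    unit : ∀ x → a * inv a a≢0 * x ≡ x
    unit x = trans (cong (_* x) (inv-r a a≢0)) (*-identityˡ x)

  -- Translation by `1#` permutes the field, so the sum of all elements does not change when `1#` is
  -- added to each of its `s` terms.
  s·1≡0 : s · 1# ≡ 0#
  s·1≡0 = begin
    s · 1#                  ≡⟨ solve 2 (λ x y → y := (x :+ y) :+ :- x) refl S (s · 1#) ⟩
    (S + s · 1#) + - S      ≡⟨ cong (_+ - S) (begin
      S + s · 1#                                ≡⟨ cong (S +_) (Sum.sum-replicate s) ⟨
      S + Sum.sum {s} (λ _ → 1#)                ≡⟨ Sum.∑-distrib-+ element (λ _ → 1#) ⟨
      Sum.sum (λ i → element i + 1#)            ≡⟨ Sum.sum-cong-≗ (λ i → sym (strictlyInverseʳ (element i + 1#))) ⟩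
      Sum.sum (λ i → element (index (element i + 1#)))
                                                ≡⟨ Sum.sum-permute element (permutation (translation 1#)) ⟨
      S                                         ∎) ⟩
    S + - S                 ≡⟨ -‿inverseʳ S ⟩
    0#                      ∎
    where S = Sum.sum element

  private
    product-single : ∀ {n} (f : Fin n → Carrier) i → (∀ j → j ≢ i → f j ≡ 1#) → Prod.sum f ≡ f i
    product-single {suc n} f zero    ones = trans
      (cong (f zero *_) (trans (Prod.sum-cong-≗ (λ j → ones (suc j) λ ())) (Prod.sum-replicate-zero n)))
      (*-identityʳ _)
    product-single {suc n} f (suc i) ones = trans
      (cong₂ _*_ (ones zero λ ()) (product-single (f ∘ suc) i (λ j j≢i → ones (suc j) (j≢i ∘ Fin.suc-injective))))
      (*-identityˡ _)

    product-nonzero : ∀ {n} (f : Fin n → Carrier) → (∀ i → f i ≢ 0#) → Prod.sum f ≢ 0#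
    product-nonzero {zero}  f nz = 1≢0
    product-nonzero {suc n} f nz = *-nonzero (nz zero) (product-nonzero (f ∘ suc) (nz ∘ suc))

    product-replicate : ∀ n x → Prod.sum {n} (λ _ → x) ≡ pow x n
    product-replicate zero    x = refl
    product-replicate (suc n) x = cong (x *_) (product-replicate n x)

  -- The product of a·φ(x) over all x, where φ(0) = 1 and φ(x) = x otherwise, equals both a^s·Π
  -- and Π·a, because the map x ↦ a x only misses the factor a at x = 0.
  opaque
    pow-order : ∀ a → pow a s ≡ a
    pow-order a with a ≟ 0#
    ... | yes refl = pow-0 s (ℕ.≤-trans (s≤s z≤n) (Fin.toℕ<n (index 0#)))
      where
      pow-0 : ∀ n → 0 ℕ.< n → pow 0# n ≡ 0#
      pow-0 (suc n) _ = zeroˡ _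
    ... | no a≢0 = *-cancelˡ P (product-nonzero (φ ∘ element) (φ≢0 ∘ element)) (begin
      P * pow a s                                       ≡⟨ *-comm _ _ ⟩
      pow a s * P                                       ≡⟨ cong (_* P) (product-replicate s a) ⟨
      Prod.sum {s} (λ _ → a) * P                        ≡⟨ Prod.∑-distrib-+ (λ _ → a) (φ ∘ element) ⟨
      Prod.sum (λ i → a * φ (element i))                ≡⟨ Prod.sum-cong-≗ (λ i → split (element i)) ⟩
      Prod.sum (λ i → φ (a * element i) * χ (element i))
        ≡⟨ Prod.∑-distrib-+ (λ i → φ (a * element i)) (χ ∘ element) ⟩
      Prod.sum (λ i → φ (a * element i)) * Prod.sum (χ ∘ element)
        ≡⟨ cong₂ _*_ dilated single ⟩
      P * a                                             ∎)
      where
      φ χ : Carrier → Carrier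
      φ x with x ≟ 0#
      ... | yes _ = 1#
      ... | no  _ = x
      χ x with x ≟ 0#
      ... | yes _ = a
      ... | no  _ = 1#
      P : Carrier
      P = Prod.sum (φ ∘ element)

      φ≢0 : ∀ x → φ x ≢ 0#
      φ≢0 x with x ≟ 0#
      ... | yes _   = 1≢0
      ... | no  x≢0 = x≢0

      split : ∀ x → a * φ x ≡ φ (a * x) * χ x
      split x with x ≟ 0# | (a * x) ≟ 0#
      ... | yes _   | yes _    = trans (*-identityʳ a) (sym (*-identityˡ a))
      ... | yes x≡0 | no  ax≢0 = contradiction (trans (cong (a *_) x≡0) (zeroʳ a)) ax≢0
      ... | no  x≢0 | yes ax≡0 = contradiction ax≡0 (*-nonzero a≢0 x≢0)
      ... | no  _   | no  _    = sym (*-identityʳ _)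

      dilated : Prod.sum (λ i → φ (a * element i)) ≡ P
      dilated = trans
        (Prod.sum-cong-≗ (λ i → cong φ (sym (strictlyInverseʳ (a * element i)))))
        (sym (Prod.sum-permute (φ ∘ element) (permutation (dilation a≢0))))

      χ-nonzero : ∀ {x} → x ≢ 0# → χ x ≡ 1#
      χ-nonzero {x} x≢0 with x ≟ 0#
      ... | yes x≡0 = contradiction x≡0 x≢0
      ... | no  _   = refl

      χ-zero : ∀ {x} → x ≡ 0# → χ x ≡ a
      χ-zero {x} x≡0 with x ≟ 0#
      ... | yes _   = refl
      ... | no  x≢0 = contradiction x≡0 x≢0

      single : Prod.sum (χ ∘ element) ≡ a
      single = trans
        (product-single (χ ∘ element) (index 0#) λ j j≢ → χ-nonzero λ ej≡0 →
          j≢ (trans (sym (strictlyInverseˡ j)) (cong index ej≡0)))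
        (χ-zero (strictlyInverseʳ 0#))

  -- Value at x of the monic polynomial with the given lower coefficients, constant term first.
  monic : ∀ {n} → Vec.Vec Carrier n → Carrier → Carrier
  monic Vec.[]       x = 1#
  monic (c Vec.∷ cs) x = c + x * monic cs x

  -- Horner's scheme for division by X - r: the intermediate values at `r` are the coefficients of
  -- the quotient.
  quotient : ∀ {n} → Vec.Vec Carrier (suc n) → Carrier → Vec.Vec Carrier n
  quotient (c Vec.∷ Vec.[])       r = Vec.[]
  quotient (c Vec.∷ cs@(_ Vec.∷ _)) r = monic cs r Vec.∷ quotient cs r

  monic-quotient : ∀ {n} (cs : Vec.Vec Carrier (suc n)) r x →
    monic cs x + - monic cs r ≡ (x + - r) * monic (quotient cs r) x
  monic-quotient (c Vec.∷ Vec.[]) r x =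
    solve 4 (λ c o x r → (c :+ x :* o) :+ :- (c :+ r :* o) := (x :+ :- r) :* o) refl c 1# x r
  monic-quotient (c Vec.∷ cs@(_ Vec.∷ _)) r x = begin
    (c + x * E x) + - (c + r * E r)
      ≡⟨ solve 5 (λ c x e r f → (c :+ x :* e) :+ :- (c :+ r :* f) := (x :+ :- r) :* f :+ x :* (e :+ :- f))
           refl c x (E x) r (E r) ⟩
    (x + - r) * E r + x * (E x + - E r)
      ≡⟨ cong (λ z → (x + - r) * E r + x * z) (monic-quotient cs r x) ⟩
    (x + - r) * E r + x * ((x + - r) * monic (quotient cs r) x)
      ≡⟨ solve 4 (λ d f x m → d :* f :+ x :* (d :* m) := d :* (f :+ x :* m)) refl (x + - r) (E r) x (monic (quotient cs r) x) ⟩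
    (x + - r) * (E r + x * monic (quotient cs r) x) ∎
    where E = monic cs

  monic-roots : ∀ {n} (cs : Vec.Vec Carrier n) (r : Fin (suc n) → Carrier) →
    (∀ {i j} → r i ≡ r j → i ≡ j) → ¬ (∀ i → monic cs (r i) ≡ 0#)
  monic-roots {zero}  Vec.[] r inj roots = 1≢0 (roots zero)
  monic-roots {suc n} cs r inj roots = monic-roots (quotient cs (r zero)) (r ∘ suc)
    (Fin.suc-injective ∘ inj) λ i →
      *-cancel {r (suc i) + - r zero} (λ eq → contradiction (inj (-≡0 eq)) λ ()) (begin
        (r (suc i) + - r zero) * monic (quotient cs (r zero)) (r (suc i))
          ≡⟨ monic-quotient cs (r zero) (r (suc i)) ⟨
        monic cs (r (suc i)) + - monic cs (r zero)
          ≡⟨ cong₂ (λ a b → a + - b) (roots (suc i)) (roots zero) ⟩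
        0# + - 0#  ≡⟨ -‿inverseʳ 0# ⟩
        0#         ∎)

  opaque
    -- The source of `norm-surjective` and `trace-nonzero`: the wanted element is a non-root of a
    -- polynomial of degree below the order of the field.
    monic-nonroot : ∀ {n} (cs : Vec.Vec Carrier n) → n ℕ.< s → ∃ λ x → monic cs x ≢ 0#
    monic-nonroot cs n<s with Fin.any? (λ i → ¬? (monic cs (element i) ≟ 0#))
    ... | yes (i , nz) = element i , nz
    ... | no  none = contradiction (λ i → decidable-stable (_ ≟ _) (λ nz → none (Fin.inject≤ i n<s , nz)))
      (monic-roots cs (λ i → element (Fin.inject≤ i n<s)) (Fin.inject≤-injective n<s n<s _ _ ∘ element-injective))

-- The rank bound

module RankBound (F : Field) (q s : ℕ) (order : HasOrder F s) where
  open Powers F q s order public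
  open Solver using (solve; _:=_; _:+_; _:*_; :-_)
  open ≡-Reasoning

  _⊗_ : ∀ {m n} → Vec m → Vec n → Vec (m ℕ.* n)
  _⊗_ {m} {n} x y t = x (proj₁ (remQuot {m} n t)) * y (proj₂ (remQuot {m} n t))

  tensorPower : ∀ {n} e → Vec n → Vec (n ℕ.^ e)
  tensorPower zero    x = λ _ → 1#
  tensorPower (suc e) x = x ⊗ tensorPower e x

  opaque
    unfolding dot

    dot-⊗ : ∀ {m n} (x x′ : Vec m) (y y′ : Vec n) → dot (x ⊗ y) (x′ ⊗ y′) ≡ dot x x′ * dot y y′
    dot-⊗ {m} {n} x x′ y y′ = begin
      ∑ (m ℕ.* n) (λ t → (x ⊗ y) t * (x′ ⊗ y′) t)
        ≡⟨ ∑-combine m n (λ t → (x ⊗ y) t * (x′ ⊗ y′) t) ⟩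
      ∑ m (λ i → ∑ n (λ j → (x ⊗ y) (combine i j) * (x′ ⊗ y′) (combine i j)))
        ≡⟨ ∑-cong m (λ i → trans (∑-cong n (λ j → entry i j)) (∑-*ˡ n (x i * x′ i) (λ j → y j * y′ j))) ⟩
      ∑ m (λ i → x i * x′ i * ∑ n (λ j → y j * y′ j))
        ≡⟨ ∑-*ʳ m (∑ n (λ j → y j * y′ j)) (λ i → x i * x′ i) ⟩
      ∑ m (λ i → x i * x′ i) * ∑ n (λ j → y j * y′ j)  ∎
      where
      entry : ∀ i j → (x ⊗ y) (combine i j) * (x′ ⊗ y′) (combine i j) ≡ x i * x′ i * (y j * y′ j)
      entry i j = trans
        (cong (λ (a , b) → x a * y b * (x′ a * y′ b)) (Fin.remQuot-combine {m} {n} i j))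
        (solve 4 (λ a b c d → a :* b :* (c :* d) := a :* c :* (b :* d)) refl (x i) (y j) (x′ i) (y′ j))

    dot-tensorPower : ∀ {n} e (x y : Vec n) → dot (tensorPower e x) (tensorPower e y) ≡ pow (dot x y) e
    dot-tensorPower zero    x y = trans (+-identityʳ _) (*-identityʳ _)
    dot-tensorPower (suc e) x y = trans (dot-⊗ x y (tensorPower e x) (tensorPower e y))
                                        (cong (dot x y *_) (dot-tensorPower e x y))

  pow-nonzero : ∀ {e x} → s ≡ suc e → x ≢ 0# → pow x e ≡ 1#
  pow-nonzero {e} {x} s≡ x≢0 = *-cancelˡ x x≢0 (trans (cong (pow x) (sym s≡)) (trans (pow-order x) (sym (*-identityʳ x))))

  -- Raising the entries of the Gram matrix to the power s − 1 gives the matrix of 1 − δ, which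
  -- factors through the tensor power, so a relation among the rows with coefficient sum 0 is trivial.
  rank-bound : ∀ {N D e} (a b : Fin N → Vec D) → s ≡ suc (suc e) →
    (∀ i → dot (a i) (b i) ≡ 0#) → (∀ {i j} → i ≢ j → dot (a i) (b j) ≢ 0#) →
    N ℕ.≤ suc (D ℕ.^ suc e)
  rank-bound {N} {D} {e} a b s≡ diagonal off = ℕ.≮⇒≥ λ small →
    -- The first equation makes the coefficients sum to 0. Without it the constant vector could be a
    -- relation, since J - I is singular when N is 1 modulo the characteristic; it accounts for the
    -- `suc` in the bound.
    absurd (kernel small ((λ _ → 1#) ∷ λ t i → tensorPower (suc e) (a i) t))
    where
    T : ℕ
    T = D ℕ.^ suc e
    row column : Fin N → Vec T
    row    i = tensorPower (suc e) (a i)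
    column j = tensorPower (suc e) (b j)

    entry : ∀ i j → dot (row i) (column j) ≡ 1# + - δ j i
    entry i j with i Fin.≟ j
    ... | yes refl = begin
      -- The exponent is a successor, so the zero on the diagonal stays zero.
      dot (row i) (column i)     ≡⟨ dot-tensorPower (suc e) (a i) (b i) ⟩
      dot (a i) (b i) * pow (dot (a i) (b i)) e
                                 ≡⟨ trans (cong (_* pow (dot (a i) (b i)) e) (diagonal i)) (zeroˡ _) ⟩
      0#                         ≡⟨ -‿inverseʳ 1# ⟨
      1# + - 1#                  ≡⟨ cong (λ z → 1# + - z) (δ-diag i) ⟨
      1# + - δ i i               ∎
    ... | no i≢j = begin
      dot (row i) (column j)     ≡⟨ dot-tensorPower (suc e) (a i) (b j) ⟩
      pow (dot (a i) (b j)) (suc e)  ≡⟨ pow-nonzero s≡ (off i≢j) ⟩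
      1#                         ≡⟨ trans (+-comm 1# _) (solve 2 (λ z o → z :+ :- z :+ o := o) refl 0# 1#) ⟨
      1# + (0# + - 0#)           ≡⟨ cong (1# +_) (+-identityˡ _) ⟩
      1# + - 0#                  ≡⟨ cong (λ z → 1# + - z) (δ-off (i≢j ∘ sym)) ⟨
      1# + - δ j i               ∎

    absurd : ¬ (Σ (Vec N) λ c → NonZero c × (∀ t → dot c (((λ _ → 1#) ∷ λ t i → row i t) t) ≡ 0#))
    absurd (c , c≢0 , eq) = c≢0 λ j → begin
      c j               ≡⟨ solve 2 (λ x s → x := s :+ :- (s :+ :- x)) refl (c j) (dot c (λ _ → 1#)) ⟩
      dot c (λ _ → 1#) + - (dot c (λ _ → 1#) + - c j)
        ≡⟨ cong₂ (λ x y → x + - y) (eq zero) (relation j) ⟩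
      0# + - 0#         ≡⟨ -‿inverseʳ 0# ⟩
      0#                ∎
      where
      c·row : IsZero (lincomb c row)
      c·row t = trans (sym (dot-∑ c (λ i → row i t))) (eq (suc t))

      relation : ∀ j → dot c (λ _ → 1#) + - c j ≡ 0#
      relation j = begin
        dot c (λ _ → 1#) + - c j
          ≡⟨ cong₂ _+_ refl (trans (sym (-1*x≈-x _)) (cong (- 1# *_) (sym (dot-δ c j)))) ⟩
        dot c (λ _ → 1#) + - 1# * dot c (δ j)
          ≡⟨ trans (dot-+ʳ c _ _) (cong (dot c (λ _ → 1#) +_) (dot-scaleʳ (- 1#) c (δ j))) ⟨
        dot c ((λ _ → 1#) +ᵛ scale (- 1#) (δ j))
          ≡⟨ dot-congʳ c (λ i → trans (cong (1# +_) (-1*x≈-x _)) (sym (entry i j))) ⟩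
        dot c (λ i → dot (row i) (column j))
          ≡⟨ trans (dot-∑ c _) (sym (dot-lincombˡ c row (column j))) ⟩
        dot (lincomb c row) (column j)   ≡⟨ dot-0ˡ c·row (column j) ⟩
        0#                               ∎

-- Conjugation x ↦ x^q on a field of order q²

module Conjugation (F : Field) (q : ℕ) (primePower : IsPrimePower q) (order : HasOrder F (q ℕ.^ 2)) where
  open Powers F q (q ℕ.^ 2) order public
  open Solver using (solve; _:=_; _:+_; _:*_; :-_)
  open ≡-Reasoning
  private
    p = proj₁ primePower
    k = proj₁ (proj₂ primePower)
    p-prime = proj₁ (proj₂ (proj₂ primePower))
    q≡p^ : q ≡ p ℕ.^ suc k
    q≡p^ = proj₂ (proj₂ (proj₂ primePower))
    module Bin = Algebra.Properties.CommutativeSemiring.Binomial commutativeSemiring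
    module Sum = Algebra.Properties.CommutativeMonoid.Sum +-commutativeMonoid
    open Algebra.Properties.CommutativeSemiring.Exp commutativeSemiring using (_^_)

  1<q : 1 ℕ.< q
  1<q = subst (1 ℕ.<_) (sym q≡p^) (ℕ.≤-trans (ℕ.nonTrivial⇒n>1 p {{prime⇒nonTrivial p-prime}})
    (subst (ℕ._≤ p ℕ.^ suc k) (ℕ.^-identityʳ p) (ℕ.^-monoʳ-≤ p {{prime⇒nonZero p-prime}} (s≤s (z≤n {k})))))

  private
    t = q ℕ.∸ 2
    q≡2+t : q ≡ suc (suc t)
    q≡2+t = sym (ℕ.m+[n∸m]≡n 1<q)

    pow≡^ : ∀ x n → pow x n ≡ x ^ n
    pow≡^ x zero    = refl
    pow≡^ x (suc n) = cong (x *_) (pow≡^ x n)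

    ·-pow : ∀ m j → (m ℕ.^ j) · 1# ≡ pow (m · 1#) j
    ·-pow m zero    = +-identityʳ 1#
    ·-pow m (suc j) = trans (×1-homo-* m (m ℕ.^ j)) (cong (m · 1# *_) (·-pow m j))

  -- A power of `p · 1#` is `(q ^ 2) · 1#`, which vanishes by `s·1≡0`, and a field has no
  -- nilpotents.
  p·1≡0 : p · 1# ≡ 0#
  p·1≡0 = pow≡0 _ (suc k ℕ.* 2) (begin
    pow (p · 1#) (suc k ℕ.* 2)     ≡⟨ ·-pow p (suc k ℕ.* 2) ⟨
    (p ℕ.^ (suc k ℕ.* 2)) · 1#     ≡⟨ cong (_· 1#) (ℕ.^-*-assoc p (suc k) 2) ⟨
    ((p ℕ.^ suc k) ℕ.^ 2) · 1#     ≡⟨ cong (λ z → (z ℕ.^ 2) · 1#) q≡p^ ⟨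
    (q ℕ.^ 2) · 1#                 ≡⟨ s·1≡0 ⟩
    0#                             ∎)

  ∣⇒·≡0 : ∀ {n} → p ∣ n → ∀ x → n · x ≡ 0#
  ∣⇒·≡0 (divides m refl) x = begin
    (m ℕ.* p) · x               ≡⟨ cong ((m ℕ.* p) ·_) (*-identityˡ x) ⟨
    (m ℕ.* p) · (1# * x)        ≡⟨ ×-assoc-* (m ℕ.* p) 1# x ⟨
    ((m ℕ.* p) · 1#) * x        ≡⟨ cong (_* x) (×1-homo-* m p) ⟩
    (m · 1# * p · 1#) * x       ≡⟨ cong (λ z → m · 1# * z * x) p·1≡0 ⟩
    (m · 1# * 0#) * x           ≡⟨ trans (cong (_* x) (zeroʳ _)) (zeroˡ x) ⟩
    0#                          ∎

  frobenius : ∀ x y → pow (x + y) p ≡ pow x p + pow y p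
  -- `p` is abstracted together with its two properties so that it can be matched as a successor,
  -- which lets both end terms of the binomial sum be split off.
  frobenius x y with p | p-prime | (λ {n} → ∣⇒·≡0 {n})
  ... | suc p′ | p-prime′ | ·≡0 = begin
    pow (x + y) (suc p′)      ≡⟨ pow≡^ (x + y) (suc p′) ⟩
    (x + y) ^ suc p′          ≡⟨ Bin.theorem (suc p′) x y ⟩
    T zero + Sum.sum (T ∘ suc)                        ≡⟨ cong (T zero +_) (Sum.sum-init-last (T ∘ suc)) ⟩
    T zero + (Sum.sum (λ i → T (suc (inject₁ i))) + T (suc (fromℕ p′)))
      ≡⟨ cong₂ (λ a b → T zero + (a + b)) (trans (Sum.sum-cong-≗ middle) (Sum.sum-replicate-zero p′)) last ⟩
    T zero + (0# + x ^ suc p′)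
      ≡⟨ cong₂ _+_ (trans (+-identityʳ _) (*-identityˡ _)) (+-identityˡ _) ⟩
    y ^ suc p′ + x ^ suc p′                           ≡⟨ +-comm _ _ ⟩
    x ^ suc p′ + y ^ suc p′   ≡⟨ cong₂ _+_ (pow≡^ x (suc p′)) (pow≡^ y (suc p′)) ⟨
    pow x (suc p′) + pow y (suc p′)                   ∎
    where
    T = Bin.binomialTerm x y (suc p′)
    middle : ∀ i → T (suc (inject₁ i)) ≡ 0#
    middle i = ·≡0 (prime∣C p-prime′ (s≤s z≤n) (s≤s (subst (ℕ._< p′) (sym (Fin.toℕ-inject₁ i)) (Fin.toℕ<n i)))) _
    last : T (suc (fromℕ p′)) ≡ x ^ suc p′
    last = begin
      T (suc (fromℕ p′))
        ≡⟨ cong (λ j → (suc p′ C suc j) · (x ^ suc j * y ^ (p′ ℕ.∸ j))) (Fin.toℕ-fromℕ p′) ⟩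
      (suc p′ C suc p′) · (x ^ suc p′ * y ^ (p′ ℕ.∸ p′))
        ≡⟨ cong₂ (λ a b → a · (x ^ suc p′ * y ^ b)) (nCn≡1 (suc p′)) (ℕ.n∸n≡0 p′) ⟩
      1 · (x ^ suc p′ * 1#)    ≡⟨ trans (+-identityʳ _) (*-identityʳ _) ⟩
      x ^ suc p′               ∎

  opaque
    conj-+ : ∀ x y → conj (x + y) ≡ conj x + conj y
    conj-+ x y = subst (λ n → pow (x + y) n ≡ pow x n + pow y n) (sym q≡p^) (iterate (suc k))
      where
      iterate : ∀ j → pow (x + y) (p ℕ.^ j) ≡ pow x (p ℕ.^ j) + pow y (p ℕ.^ j)
      iterate zero    = trans (*-identityʳ _) (sym (cong₂ _+_ (*-identityʳ x) (*-identityʳ y)))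
      iterate (suc j) = begin
        pow (x + y) (p ℕ.* p ℕ.^ j)                    ≡⟨ pow-* (x + y) p (p ℕ.^ j) ⟩
        pow (pow (x + y) (p ℕ.^ j)) p                  ≡⟨ cong (λ z → pow z p) (iterate j) ⟩
        pow (pow x (p ℕ.^ j) + pow y (p ℕ.^ j)) p      ≡⟨ frobenius _ _ ⟩
        pow (pow x (p ℕ.^ j)) p + pow (pow y (p ℕ.^ j)) p
          ≡⟨ cong₂ _+_ (pow-* x p (p ℕ.^ j)) (pow-* y p (p ℕ.^ j)) ⟨
        pow x (p ℕ.* p ℕ.^ j) + pow y (p ℕ.* p ℕ.^ j)  ∎

  conj-* : ∀ x y → conj (x * y) ≡ conj x * conj y
  conj-* x y = pow-distrib x y q

  conj-0 : conj 0# ≡ 0#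
  conj-0 = trans (cong (pow 0#) q≡2+t) (zeroˡ _)

  conj-conj : ∀ x → conj (conj x) ≡ x
  conj-conj x = begin
    pow (pow x q) q      ≡⟨ pow-* x q q ⟨
    pow x (q ℕ.* q)      ≡⟨ cong (λ z → pow x (q ℕ.* z)) (ℕ.*-identityʳ q) ⟨
    pow x (q ℕ.^ 2)      ≡⟨ pow-order x ⟩
    x                    ∎

  conj-neg : ∀ x → conj (- x) ≡ - conj x
  conj-neg x = -≡0 (begin
    conj (- x) + - - conj x   ≡⟨ solve 2 (λ a b → a :+ :- (:- b) := a :+ b) refl (conj (- x)) (conj x) ⟩
    conj (- x) + conj x       ≡⟨ conj-+ (- x) x ⟨
    conj (- x + x)            ≡⟨ cong conj (-‿inverseˡ x) ⟩
    conj 0#                   ≡⟨ conj-0 ⟩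
    0#                        ∎)

  conj-nonzero : ∀ {x} → x ≢ 0# → conj x ≢ 0#
  conj-nonzero x≢0 eq = x≢0 (pow≡0 _ q eq)

  conj-inv : ∀ {x} (x≢0 : x ≢ 0#) → conj x ≡ x → conj (inv x x≢0) ≡ inv x x≢0
  conj-inv {x} x≢0 fixed = *-cancelˡ x x≢0 (begin
    x * conj (inv x x≢0)         ≡⟨ cong (_* conj (inv x x≢0)) fixed ⟨
    conj x * conj (inv x x≢0)    ≡⟨ conj-* x _ ⟨
    conj (x * inv x x≢0)         ≡⟨ cong conj (inv-r x x≢0) ⟩
    conj 1#                      ≡⟨ pow-1 q ⟩
    1#                           ≡⟨ inv-r x x≢0 ⟨
    x * inv x x≢0                ∎)

  conj-∑ : ∀ n f → conj (∑ n f) ≡ ∑ n (conj ∘ f)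
  conj-∑ zero    f = conj-0
  conj-∑ (suc n) f = trans (conj-+ _ _) (cong (conj (f zero) +_) (conj-∑ n (f ∘ suc)))

  private
    fixed⇒pow≡1 : ∀ {a} → a ≢ 0# → conj a ≡ a → pow a (suc t) ≡ 1#
    fixed⇒pow≡1 {a} a≢0 fixed = *-cancelˡ a a≢0 (begin
      pow a (suc (suc t))  ≡⟨ cong (pow a) q≡2+t ⟨
      conj a               ≡⟨ fixed ⟩
      a                    ≡⟨ *-identityʳ a ⟨
      a * 1#               ∎)

    monic-shift : ∀ m {n} (cs : Vec.Vec Carrier n) x →
      monic (Vec.replicate m 0# Vec.++ cs) x ≡ pow x m * monic cs x
    monic-shift zero    cs x = sym (*-identityˡ _)
    monic-shift (suc m) cs x = begin
      0# + x * monic (Vec.replicate m 0# Vec.++ cs) x  ≡⟨ +-identityˡ _ ⟩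
      x * monic (Vec.replicate m 0# Vec.++ cs) x       ≡⟨ cong (x *_) (monic-shift m cs x) ⟩
      x * (pow x m * monic cs x)                       ≡⟨ *-assoc _ _ _ ⟨
      x * pow x m * monic cs x                         ∎

    -- Coefficients of (N(X)^(j+1) − a^(j+1)) / (N(X) − a) for N(X) = X^(q+1).
    geometric : Carrier → ∀ j → Vec.Vec Carrier (j ℕ.* suc q)
    geometric a zero    = Vec.[]
    geometric a (suc j) = pow a (suc j) Vec.∷ (Vec.replicate q 0# Vec.++ geometric a j)

    monic-geometric : ∀ a j x → (x * conj x + - a) * monic (geometric a j) x ≡ pow (x * conj x) (suc j) + - pow a (suc j)
    monic-geometric a zero    x = solve 3 (λ y a o → (y :+ :- a) :* o := y :* o :+ :- (a :* o)) refl (x * conj x) a 1#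
    monic-geometric a (suc j) x = begin
      (y + - a) * (A + x * monic (Vec.replicate q 0# Vec.++ geometric a j) x)
        ≡⟨ cong (λ z → (y + - a) * (A + x * z)) (monic-shift q (geometric a j) x) ⟩
      (y + - a) * (A + x * (conj x * g))
        ≡⟨ solve 5 (λ x c a A g → (x :* c :+ :- a) :* (A :+ x :* (c :* g))
             := (x :* c :+ :- a) :* A :+ x :* c :* ((x :* c :+ :- a) :* g)) refl x (conj x) a A g ⟩
      (y + - a) * A + y * ((y + - a) * g)
        ≡⟨ cong (λ z → (y + - a) * A + y * z) (monic-geometric a j x) ⟩
      (y + - a) * A + y * (pow y (suc j) + - A)
        ≡⟨ solve 4 (λ y a A b → (y :+ :- a) :* A :+ y :* (b :+ :- A) := y :* b :+ :- (a :* A)) refl y a A (pow y (suc j)) ⟩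
      y * pow y (suc j) + - (a * A) ∎
      where
      y = x * conj x
      A = pow a (suc j)
      g = monic (geometric a j) x

  conj-norm : ∀ x → conj (x * conj x) ≡ x * conj x
  conj-norm x = trans (conj-* x (conj x)) (trans (cong (conj x *_) (conj-conj x)) (*-comm _ _))

  opaque
    -- For `a` nonzero, take a non-root `x` of X · (N(X)^(q-1) - a^(q-1)) / (N(X) - a), whose degree
    -- is q² - q - 1. The factor X makes `x` nonzero, so N(x) and `a` are nonzero fixed elements and
    -- both have (q-1)-st power 1. The product of N(x) - a and the nonzero quotient is therefore 0.
    norm-surjective : ∀ {a} → conj a ≡ a → ∃ λ c → c * conj c ≡ a
    norm-surjective {a} fixed with a ≟ 0#
    ... | yes refl = 0# , zeroˡ _
    ... | no  a≢0 with monic-nonroot (0# Vec.∷ geometric a t) degree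
      where
      degree : suc (t ℕ.* suc q) ℕ.< q ℕ.^ 2
      degree = subst (λ z → suc (t ℕ.* suc z) ℕ.< z ℕ.^ 2) (sym q≡2+t) (ℕ.≤-trans (ℕ.m≤m+n _ (2 ℕ.+ t)) (ℕ.≤-reflexive
        (solveℕ 1 (λ t → con 2 :+ℕ t :*ℕ (con 3 :+ℕ t) :+ℕ (con 2 :+ℕ t) :=ℕ (con 2 :+ℕ t) :*ℕ ((con 2 :+ℕ t) :*ℕ con 1)) refl t)))
        where open +-*-Solver using (con) renaming (solve to solveℕ; _:=_ to _:=ℕ_; _:+_ to _:+ℕ_; _:*_ to _:*ℕ_)
    ... | x , nz = x , -≡0 (*-cancel g≢0 (begin
      g * (y + - a)                     ≡⟨ *-comm _ _ ⟩
      (y + - a) * g                     ≡⟨ monic-geometric a t x ⟩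
      pow y (suc t) + - pow a (suc t)   ≡⟨ cong₂ (λ b c → b + - c) (fixed⇒pow≡1 y≢0 (conj-norm x)) (fixed⇒pow≡1 a≢0 fixed) ⟩
      1# + - 1#                         ≡⟨ -‿inverseʳ 1# ⟩
      0#                                ∎))
      where
      y g : Carrier
      y = x * conj x
      g = monic (geometric a t) x
      xg≢0 : x * g ≢ 0#
      xg≢0 eq = nz (trans (+-identityˡ _) eq)
      x≢0 : x ≢ 0#
      x≢0 eq = xg≢0 (trans (cong (_* g) eq) (zeroˡ _))
      g≢0 : g ≢ 0#
      g≢0 eq = xg≢0 (trans (cong (x *_) eq) (zeroʳ _))
      y≢0 : y ≢ 0#
      y≢0 = *-nonzero x≢0 (conj-nonzero x≢0)

  opaque
    -- X^q + X has degree q < q², so it has a non-root. The choice `c = 1#` would fail in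
    -- characteristic 2.
    trace-nonzero : ∃ λ c → c + conj c ≢ 0#
    trace-nonzero with monic-nonroot (0# Vec.∷ 1# Vec.∷ (Vec.replicate t 0# Vec.++ Vec.[])) degree
      where
      degree : suc (suc (t ℕ.+ 0)) ℕ.< q ℕ.^ 2
      degree = subst₂ ℕ._<_ (trans q≡2+t (cong (λ z → suc (suc z)) (sym (ℕ.+-identityʳ t)))) (cong (q ℕ.*_) (sym (ℕ.*-identityʳ q)))
        (ℕ.m<m*n q q {{ℕ.>-nonZero (ℕ.<-trans (s≤s z≤n) 1<q)}} 1<q)
    ... | c , nz = c , λ eq → nz (begin
      0# + c * (1# + c * monic (Vec.replicate t 0# Vec.++ Vec.[]) c)
        ≡⟨ cong (λ z → 0# + c * (1# + c * z)) (trans (monic-shift t Vec.[] c) (*-identityʳ _)) ⟩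
      0# + c * (1# + c * pow c t)      ≡⟨ trans (+-identityˡ _) (distribˡ _ _ _) ⟩
      c * 1# + c * (c * pow c t)       ≡⟨ cong₂ _+_ (*-identityʳ c) (cong (pow c) (sym q≡2+t)) ⟩
      c + conj c                       ≡⟨ eq ⟩
      0#                               ∎)

-- Hermitian forms

module HermitianSpace
  (F : Field) (q : ℕ) (primePower : IsPrimePower q) (order : HasOrder F (q ℕ.^ 2))
  {n : ℕ} (A : Hermitian.Matrix F q n) (hermitian : Hermitian.IsHermitianMatrix F q A) where
  open Conjugation F q primePower order public
  open Solver using (solve; _:=_; _:+_; _:*_; :-_)
  open ≡-Reasoning

  -- The covector of `h` with second argument `y`; through it orthogonality becomes a linear
  -- equation for `kernel` and `dual-basis`.
  L : Vec n → Vec n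
  L y i = ∑ n (λ j → A i j * conj (y j))

  opaque
    h : Vec n → Vec n → Carrier
    h = form A

    h≡form : ∀ x y → h x y ≡ form A x y
    h≡form x y = refl

    h≡dot : ∀ x y → h x y ≡ dot x (L y)
    h≡dot x y = trans (∑-cong n λ i → trans
      (∑-cong n λ j → *-assoc (x i) (A i j) (conj (y j)))
      (∑-*ˡ n (x i) (λ j → A i j * conj (y j)))) (sym (dot-∑ x (L y)))

    h-sym : ∀ x y → h y x ≡ conj (h x y)
    h-sym x y = sym (begin
      conj (∑ n (λ i → ∑ n (λ j → x i * A i j * conj (y j))))
        ≡⟨ trans (conj-∑ n _) (∑-cong n λ i → conj-∑ n _) ⟩
      ∑ n (λ i → ∑ n (λ j → conj (x i * A i j * conj (y j))))
        ≡⟨ ∑-cong n (λ i → ∑-cong n (λ j → term i j)) ⟩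
      ∑ n (λ i → ∑ n (λ j → y j * A j i * conj (x i)))
        ≡⟨ ∑-comm n n (λ i j → y j * A j i * conj (x i)) ⟩
      ∑ n (λ j → ∑ n (λ i → y j * A j i * conj (x i)))  ∎)
      where
      term : ∀ i j → conj (x i * A i j * conj (y j)) ≡ y j * A j i * conj (x i)
      term i j = begin
        conj (x i * A i j * conj (y j))          ≡⟨ trans (conj-* _ _) (cong (_* conj (conj (y j))) (conj-* _ _)) ⟩
        conj (x i) * conj (A i j) * conj (conj (y j))
          ≡⟨ cong₂ (λ a b → conj (x i) * a * b) (sym (hermitian i j)) (conj-conj (y j)) ⟩
        conj (x i) * A j i * y j
          ≡⟨ solve 3 (λ x a y → x :* a :* y := y :* a :* x) refl (conj (x i)) (A j i) (y j) ⟩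
        y j * A j i * conj (x i)                 ∎

  h-fixed : ∀ x → conj (h x x) ≡ h x x
  h-fixed x = sym (h-sym x x)

  ⊥-sym : ∀ {x y} → h x y ≡ 0# → h y x ≡ 0#
  ⊥-sym {x} {y} eq = trans (h-sym x y) (trans (cong conj eq) conj-0)

  h-congˡ : ∀ {x y} z → (∀ i → x i ≡ y i) → h x z ≡ h y z
  h-congˡ z eq = trans (h≡dot _ z) (trans (dot-congˡ (L z) eq) (sym (h≡dot _ z)))

  h-+ˡ : ∀ x y z → h (x +ᵛ y) z ≡ h x z + h y z
  h-+ˡ x y z = trans (h≡dot _ z) (trans (dot-+ˡ x y (L z)) (cong₂ _+_ (sym (h≡dot x z)) (sym (h≡dot y z))))

  h-scaleˡ : ∀ c x z → h (scale c x) z ≡ c * h x z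
  h-scaleˡ c x z = trans (h≡dot _ z) (trans (dot-scaleˡ c x (L z)) (cong (c *_) (sym (h≡dot x z))))

  h-lincombˡ : ∀ {k} c (v : Fin k → Vec n) z → h (lincomb c v) z ≡ ∑ k (λ j → c j * h (v j) z)
  h-lincombˡ {k} c v z = trans (h≡dot _ z) (trans (dot-lincombˡ c v (L z))
    (∑-cong k λ j → cong (c j *_) (sym (h≡dot (v j) z))))

  -- Conjugating the coefficients in advance cancels the semilinearity of the second argument, so a
  -- relation among the covectors `L (v j)` can be traced back to the vectors `v j`.
  h-lincombʳ : ∀ {k} c (v : Fin k → Vec n) z → h z (lincomb (conj ∘ c) v) ≡ ∑ k (λ j → c j * h z (v j))
  h-lincombʳ {k} c v z = begin
    h z (lincomb (conj ∘ c) v)                      ≡⟨ h-sym _ z ⟩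
    conj (h (lincomb (conj ∘ c) v) z)               ≡⟨ cong conj (h-lincombˡ (conj ∘ c) v z) ⟩
    conj (∑ k (λ j → conj (c j) * h (v j) z))       ≡⟨ conj-∑ k _ ⟩
    ∑ k (λ j → conj (conj (c j) * h (v j) z))
      ≡⟨ ∑-cong k (λ j → trans (conj-* _ _) (cong₂ _*_ (conj-conj (c j)) (sym (h-sym (v j) z)))) ⟩
    ∑ k (λ j → c j * h z (v j))                     ∎

  span-⊥ : ∀ {k} {v : Fin k → Vec n} {x z} → InSpan x v → (∀ i → h (v i) z ≡ 0#) → h x z ≡ 0#
  span-⊥ {k} {v} {x} {z} (c , eq) v⊥z = begin
    h x z                         ≡⟨ h-congˡ z eq ⟩
    h (lincomb c v) z             ≡⟨ h-lincombˡ c v z ⟩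
    ∑ k (λ j → c j * h (v j) z)   ≡⟨ ∑-cong k (λ j → trans (cong (c j *_) (v⊥z j)) (zeroʳ _)) ⟩
    ∑ k (λ j → 0#)                ≡⟨ ∑-0 k ⟩
    0#                            ∎

  line-⊥ : ∀ {x y z} c → h x z ≡ 0# → h y z ≡ 0# → h (x +ᵛ scale c y) z ≡ 0#
  line-⊥ {x} {y} {z} c x⊥z y⊥z = begin
    h (x +ᵛ scale c y) z       ≡⟨ trans (h-+ˡ x _ z) (cong (h x z +_) (h-scaleˡ c y z)) ⟩
    h x z + c * h y z          ≡⟨ cong₂ (λ a b → a + c * b) x⊥z y⊥z ⟩
    0# + c * 0#                ≡⟨ trans (+-identityˡ _) (zeroʳ c) ⟩
    0#                         ∎

  h-line : ∀ c x y → h (x +ᵛ scale c y) (x +ᵛ scale c y) ≡ h x x + conj c * h x y + c * h y x + c * conj c * h y y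
  h-line c x y = begin
    h z z                        ≡⟨ trans (h-+ˡ x _ z) (cong (h x z +_) (h-scaleˡ c y z)) ⟩
    h x z + c * h y z            ≡⟨ cong₂ (λ a b → a + c * b) (right x) (right y) ⟩
    (h x x + conj c * h x y) + c * (h y x + conj c * h y y)
      ≡⟨ solve 6 (λ a b e f c c′ → (a :+ c′ :* b) :+ c :* (e :+ c′ :* f) := a :+ c′ :* b :+ c :* e :+ c :* c′ :* f)
           refl (h x x) (h x y) (h y x) (h y y) c (conj c) ⟩
    h x x + conj c * h x y + c * h y x + c * conj c * h y y ∎
    where
    z = x +ᵛ scale c y
    right : ∀ w → h w z ≡ h w x + conj c * h w y
    right w = begin
      h w z                              ≡⟨ h-sym z w ⟩
      conj (h z w)                       ≡⟨ cong conj (trans (h-+ˡ x _ w) (cong (h x w +_) (h-scaleˡ c y w))) ⟩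
      conj (h x w + c * h y w)           ≡⟨ trans (conj-+ _ _) (cong (conj (h x w) +_) (conj-* _ _)) ⟩
      conj (h x w) + conj c * conj (h y w)
        ≡⟨ cong₂ (λ a b → a + conj c * b) (sym (h-sym x w)) (sym (h-sym y w)) ⟩
      h w x + conj c * h w y             ∎

  -- A basis u of a totally isotropic subspace together with dual covectors, which witness
  -- linear independence and read off coordinates.
  record Frame {k : ℕ} (u : Fin k → Vec n) : Set where
    field
      covectors : Fin k → Vec n
      dual      : Dual u covectors
      isotropic : ∀ i j → h (u i) (u j) ≡ 0#

    independent : LinIndep u
    independent = dual⇒LinIndep u covectors dual

    span-isotropic : ∀ {x y} → InSpan x u → InSpan y u → h x y ≡ 0#
    span-isotropic x∈ y∈ = span-⊥ x∈ λ i → ⊥-sym (span-⊥ y∈ λ j → isotropic j i)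

  open Frame public

  module _ {k : ℕ} {u : Fin k → Vec n} (fr : Frame u) where

    ∷-isotropic : ∀ x → h x x ≡ 0# → (∀ i → h x (u i) ≡ 0#) → ∀ i j → h ((x ∷ u) i) ((x ∷ u) j) ≡ 0#
    ∷-isotropic x xx xu zero    zero    = xx
    ∷-isotropic x xx xu zero    (suc j) = xu j
    ∷-isotropic x xx xu (suc i) zero    = ⊥-sym (xu i)
    ∷-isotropic x xx xu (suc i) (suc j) = isotropic fr i j

    opaque
      frame-extend : ∀ x → h x x ≡ 0# → (∀ i → h x (u i) ≡ 0#) → ¬ InSpan x u → Frame (x ∷ u)
      frame-extend x xx xu x∉u with dual-extend u (covectors fr) (dual fr) x
      ... | inj₁ x∈u = contradiction x∈u x∉u
      ... | inj₂ (g , dual) = record { covectors = g ; dual = dual ; isotropic = ∷-isotropic x xx xu }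

    private
      -- The covectors are among the equations because a solution in the span of `u` then has all
      -- coordinates 0: every nonzero solution lies outside the span.
      equations : Fin (k ℕ.+ k) → Vec n
      equations = (L ∘ u) Vector.++ covectors fr

      ⊥u : ∀ x → (∀ i → dot x (equations i) ≡ 0#) → ∀ i → h x (u i) ≡ 0#
      ⊥u x eq i = begin
        h x (u i)                    ≡⟨ h≡dot x (u i) ⟩
        dot x (L (u i))              ≡⟨ cong (dot x) (lookup-++ˡ (L ∘ u) (covectors fr) i) ⟨
        dot x (equations (i ↑ˡ k))   ≡⟨ eq (i ↑ˡ k) ⟩
        0#                           ∎

      span-zero : ∀ x → (∀ i → dot x (equations i) ≡ 0#) → InSpan x u → IsZero x
      span-zero x eq (c , x≡) i = begin
        x i                   ≡⟨ x≡ i ⟩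
        ∑ k (λ j → c j * u j i)
          ≡⟨ ∑-cong k (λ j → trans (cong (_* u j i) (c≡0 j)) (zeroˡ (u j i))) ⟩
        ∑ k (λ j → 0#)        ≡⟨ ∑-0 k ⟩
        0#                    ∎
        where
        c≡0 : ∀ j → c j ≡ 0#
        c≡0 j = begin
          c j                              ≡⟨ dual-coefficient u (covectors fr) (dual fr) c j ⟨
          dot (lincomb c u) (covectors fr j)   ≡⟨ dot-congˡ (covectors fr j) x≡ ⟨
          dot x (covectors fr j)           ≡⟨ cong (dot x) (lookup-++ʳ (L ∘ u) (covectors fr) j) ⟨
          dot x (equations (k ↑ʳ j))       ≡⟨ eq (k ↑ʳ j) ⟩
          0#                               ∎

    -- Among the vectors orthogonal to u and killed by its covectors take b ≠ 0, and a ≠ 0 also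
    -- orthogonal to b; unless b is isotropic, norms supply c with a + c b isotropic.
    opaque
      isotropic-extension : suc (k ℕ.+ k) ℕ.< n → ∃ λ x → Frame (x ∷ u)
      isotropic-extension 2k+1<n with kernel (ℕ.<-trans (ℕ.n<1+n (k ℕ.+ k)) 2k+1<n) equations
      -- The condition `a ⊥ b` is the last of `2 k + 1` equations, which is what the bound on `n`
      -- leaves room for.
      ... | b , b≢0 , eq-b with kernel 2k+1<n (L b ∷ equations)
      ... | a , a≢0 , eq-a with h b b ≟ 0#
      ... | yes bb≡0 = b , frame-extend b bb≡0 (⊥u b eq-b) (b≢0 ∘ span-zero b eq-b)
      ... | no bb≢0 with norm-surjective {a = - h a a * inv (h b b) bb≢0} (trans (conj-* _ _)
                           (cong₂ _*_ (trans (conj-neg _) (cong -_ (h-fixed a))) (conj-inv bb≢0 (h-fixed b))))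
      ... | c , N≡ = x , frame-extend x x⊥x (⊥u x eq-x) (x≢0 ∘ span-zero x eq-x)
        where
        x : Vec n
        x = a +ᵛ scale c b
        a⊥b : h a b ≡ 0#
        a⊥b = trans (h≡dot a b) (eq-a zero)
        eq-x : ∀ i → dot x (equations i) ≡ 0#
        eq-x i = begin
          dot x (equations i)   ≡⟨ trans (dot-+ˡ a _ _) (cong (dot a (equations i) +_) (dot-scaleˡ c b _)) ⟩
          dot a (equations i) + c * dot b (equations i)
                                ≡⟨ cong₂ (λ s t → s + c * t) (eq-a (suc i)) (eq-b i) ⟩
          0# + c * 0#           ≡⟨ trans (+-identityˡ _) (zeroʳ c) ⟩
          0#                    ∎
        x⊥x : h x x ≡ 0#
        x⊥x = begin
          h x x     ≡⟨ h-line c a b ⟩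
          h a a + conj c * h a b + c * h b a + c * conj c * h b b
            ≡⟨ cong₂ (λ s t → h a a + conj c * s + c * t + c * conj c * h b b) a⊥b (⊥-sym a⊥b) ⟩
          h a a + conj c * 0# + c * 0# + c * conj c * h b b
            ≡⟨ cong₂ (λ s t → h a a + s + t + c * conj c * h b b) (zeroʳ _) (zeroʳ _) ⟩
          h a a + 0# + 0# + c * conj c * h b b
            ≡⟨ cong₂ (λ s t → s + t * h b b) (trans (+-identityʳ _) (+-identityʳ _)) N≡ ⟩
          h a a + - h a a * inv (h b b) bb≢0 * h b b
            ≡⟨ solve 3 (λ a i b → a :+ :- a :* i :* b := a :+ :- a :* (b :* i)) refl (h a a) (inv (h b b) bb≢0) (h b b) ⟩
          h a a + - h a a * (h b b * inv (h b b) bb≢0)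
            ≡⟨ cong (λ s → h a a + - h a a * s) (inv-r _ bb≢0) ⟩
          h a a + - h a a * 1#  ≡⟨ trans (cong (h a a +_) (*-identityʳ _)) (-‿inverseʳ _) ⟩
          0#                    ∎
        -- If `x` vanished, pairing it with `b` would give `c = 0`, since `a ⊥ b` and `b` is not
        -- isotropic, and then `a = 0`.
        x≢0 : NonZero x
        x≢0 x≡0 = a≢0 λ i → begin
          a i              ≡⟨ +-identityʳ (a i) ⟨
          a i + 0#         ≡⟨ cong (a i +_) (trans (cong (_* b i) c≡0) (zeroˡ _)) ⟨
          a i + c * b i    ≡⟨ x≡0 i ⟩
          0#               ∎
          where
          c≡0 : c ≡ 0#
          c≡0 = *-cancel bb≢0 (begin
            h b b * c              ≡⟨ *-comm _ _ ⟩
            c * h b b              ≡⟨ +-identityˡ _ ⟨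
            0# + c * h b b         ≡⟨ cong (_+ c * h b b) a⊥b ⟨
            h a b + c * h b b      ≡⟨ trans (h-+ˡ a _ b) (cong (h a b +_) (h-scaleˡ c b b)) ⟨
            h x b                  ≡⟨ trans (h≡dot x b) (dot-0ˡ x≡0 (L b)) ⟩
            0#                     ∎)

  opaque
    -- Nondegeneracy keeps the covectors `L (v i)` independent. Covectors dual to these are again
    -- vectors, now dual to `v` under the form.
    dual-to-form : Hermitian.IsNonDegenerate F q A → ∀ {k} (v : Fin k → Vec n) → LinIndep v →
      Σ (Fin k → Vec n) λ y → ∀ i j → h (y j) (v i) ≡ δ i j
    dual-to-form nondegenerate {k} v ind with dual-basis (L ∘ v) independentL
      where
      independentL : LinIndep (L ∘ v)
      independentL c z j = begin
        c j                   ≡⟨ conj-conj (c j) ⟨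
        conj (conj (c j))     ≡⟨ cong conj (ind (conj ∘ c) (nondegenerate w w⊥) j) ⟩
        conj 0#               ≡⟨ conj-0 ⟩
        0#                    ∎
        where
        w : Vec n
        w = lincomb (conj ∘ c) v
        w⊥ : ∀ x → form A w x ≡ 0#
        w⊥ x = trans (sym (h≡form w x)) (⊥-sym (begin
          h x w                                  ≡⟨ h-lincombʳ c v x ⟩
          ∑ k (λ j → c j * h x (v j))            ≡⟨ ∑-cong k (λ j → cong (c j *_) (h≡dot x (v j))) ⟩
          ∑ k (λ j → c j * dot x (L (v j)))      ≡⟨ dot-lincombʳ c (L ∘ v) x ⟨
          dot x (lincomb c (L ∘ v))              ≡⟨ dot-0ʳ z x ⟩
          0#                                     ∎))
    ... | y , dual = y , λ i j → trans (h≡dot (y j) (v i)) (trans (dot-comm _ _) (dual i j))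

-- Counting the points of an ovoid

module Ovoid
  (F : Field) (q : ℕ) (primePower : IsPrimePower q) (order : HasOrder F (q ℕ.^ 2))
  (d : ℕ) (A : Hermitian.Matrix F q (d ℕ.+ d)) (hermitian : Hermitian.IsHermitianMatrix F q A)
  (nondegenerate : Hermitian.IsNonDegenerate F q A)
  (O : Hermitian.Vec F q (d ℕ.+ d) → Set) (ovoid : Hermitian.IsOvoid F q d A O) where
  open HermitianSpace F q primePower order A hermitian public
  open Solver using (solve; _:=_; _:+_; _:*_; :-_)
  open ≡-Reasoning
  private
    V = Vec (d ℕ.+ d)
    s = q ℕ.^ 2
    element = Inverse.from order

  opaque
    -- Induction on the missing dimension `m`: while `k < d`, the bound `2 k + 1 < 2 d` of
    -- `isotropic-extension` holds.
    complete : ∀ m {k} {u : Fin k → V} → m ℕ.+ k ≡ d → Frame u →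
      Σ (Fin d → V) λ v → Frame v × (∀ {x} → InSpan x u → InSpan x v)
    complete zero    {u = u} refl fr = u , fr , λ x∈u → x∈u
    complete (suc m) {k} {u} eq   fr with isotropic-extension fr room
      where
      k<d : k ℕ.< d
      k<d = subst (k ℕ.<_) eq (s≤s (ℕ.m≤n+m k m))
      room : suc (k ℕ.+ k) ℕ.< d ℕ.+ d
      room = subst (ℕ._≤ d ℕ.+ d) (cong suc (ℕ.+-suc k k)) (ℕ.+-mono-≤ k<d k<d)
    ... | x , fr′ with complete m (trans (ℕ.+-suc m k) eq) fr′
    ... | v , frv , ⊆v = v , frv , λ x∈u → ⊆v (span-tail x u x∈u)

  frame⇒generator : {v : Fin d → V} → Frame v → IsGenerator d A v
  frame⇒generator fr = independent fr , λ i j → trans (sym (h≡form _ _)) (isotropic fr i j)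

  -- `O x` alone does not say that `x` is isotropic; here this follows from lying in a generator,
  -- and it is carried along from now on.
  ovoid-point : ∀ m {k} {u : Fin k → V} → m ℕ.+ k ≡ d → Frame u →
    ∃ λ x → O x × h x x ≡ 0# × (∀ y → InSpan y u → O y → SamePoint x y)
  ovoid-point m eq fr with complete m eq fr
  ... | v , frv , ⊆v with proj₂ ovoid v (frame⇒generator frv)
  ... | x , x∈v , Ox , unique = x , Ox , span-isotropic frv x∈v x∈v , λ y y∈u → unique y (⊆v y∈u)

  samePoint-join : ∀ {z x y : V} → SamePoint z x → SamePoint z y → SamePoint x y
  samePoint-join {z} {x} {y} (a , a≢0 , x≡) (b , b≢0 , y≡) = b * inv a a≢0 ,
    *-nonzero b≢0 (λ eq → 1≢0 (trans (sym (inv-r a a≢0)) (trans (cong (a *_) eq) (zeroʳ a)))) , λ i → begin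
    y i                         ≡⟨ y≡ i ⟩
    b * z i                     ≡⟨ cong (b *_) (trans (cong (_* z i) (inv-r a a≢0)) (*-identityˡ (z i))) ⟨
    b * (a * inv a a≢0 * z i)
      ≡⟨ solve 4 (λ a b i z → b :* (a :* i :* z) := b :* i :* (a :* z)) refl a b (inv a a≢0) (z i) ⟩
    b * inv a a≢0 * (a * z i)   ≡⟨ cong (b * inv a a≢0 *_) (x≡ i) ⟨
    b * inv a a≢0 * x i         ∎

  samePoint-⊥ : ∀ {x y z : V} → SamePoint x y → h x z ≡ 0# → h y z ≡ 0#
  samePoint-⊥ {x} {y} {z} (c , _ , y≡) x⊥z = begin
    h y z            ≡⟨ h-congˡ z y≡ ⟩
    h (scale c x) z  ≡⟨ h-scaleˡ c x z ⟩
    c * h x z        ≡⟨ trans (cong (c *_) x⊥z) (zeroʳ c) ⟩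
    0#               ∎

  ∅ : Fin 0 → V
  ∅ ()

  emptyFrame : Frame ∅
  emptyFrame = record { covectors = ∅ ; dual = λ () ; isotropic = λ () }

  opaque
    -- Dependent vectors are multiples of each other. Independent ones span a totally isotropic
    -- line, for which `1 < d` leaves room, and both coincide with the one point of `O` in a
    -- generator through it.
    orthogonal⇒samePoint : 1 ℕ.< d → ∀ {x y} → O x → h x x ≡ 0# → O y → h y y ≡ 0# → h x y ≡ 0# → SamePoint x y
    orthogonal⇒samePoint 1<d {x} {y} Ox xx Oy yy xy
      with dual-extend (x ∷ ∅) (covectors frx) (dual frx) y
      where
      frx : Frame (x ∷ ∅)
      frx = frame-extend emptyFrame x xx (λ ()) λ { (_ , x≡0) → proj₁ (proj₁ ovoid) x Ox x≡0 }
    ... | inj₁ (c , y≡) = c zero , (λ c≡0 → proj₁ (proj₁ ovoid) y Oy λ i → trans (y≡′ i) (trans (cong (_* x i) c≡0) (zeroˡ _))) , y≡′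
      where
      y≡′ : ∀ i → y i ≡ c zero * x i
      y≡′ i = trans (y≡ i) (+-identityʳ _)
    ... | inj₂ (g , dual) = samePoint-join (proj₂ (proj₂ (proj₂ z)) x (span-tail y (x ∷ ∅) (span-head x ∅)) Ox)
                                           (proj₂ (proj₂ (proj₂ z)) y (span-head y (x ∷ ∅)) Oy)
      where
      frame : Frame (y ∷ (x ∷ ∅))
      frame = record { covectors = g ; dual = dual ; isotropic = λ
        { zero zero → yy ; zero (suc zero) → ⊥-sym xy ; (suc zero) zero → xy ; (suc zero) (suc zero) → xx } }
      z : ∃ λ z → O z × h z z ≡ 0# × (∀ w → InSpan w (y ∷ (x ∷ ∅)) → O w → SamePoint z w)
      z = ovoid-point (d ℕ.∸ 2) (ℕ.m∸n+n≡m 1<d) frame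

  Disjoint : ∀ {k} → (Fin k → V) → Set
  Disjoint u = ∀ x → O x → ¬ InSpan x u

  -- In the quotient of u^⊥ by a frame u of dimension d − 1, p spans an isotropic point; a vector y
  -- with h(y , p) = 1 is moved along p to an isotropic one by solving c + c^q = − h(y , y).
  opaque
    secondPoint : ∀ {k} {u : Fin k → V} → suc k ≡ d → Frame u → Disjoint u →
      ∀ {p} → O p → h p p ≡ 0# → (∀ i → h p (u i) ≡ 0#) →
      ∃ λ x → O x × h x x ≡ 0# × (∀ i → h x (u i) ≡ 0#) × h x p ≢ 0#
    secondPoint {k} {u} refl fr disjoint {p} Op pp pu
      with dual-to-form nondegenerate (p ∷ u) (independent (frame-extend fr p pp pu (disjoint p Op))) | trace-nonzero
    ... | y , y-dual | c₀ , t≢0 = found (proj₂ ovoid (y′ ∷ u) (frame⇒generator fr′))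
      where
      y₀ y′ : V
      t c : Carrier
      y₀ = y zero
      t = c₀ + conj c₀
      -- The factor in front of `c₀` is fixed by `conj`, so it multiplies the trace `t` of `c₀` as
      -- well and turns it into `- h y₀ y₀`.
      c = - h y₀ y₀ * inv t t≢0 * c₀
      y′ = y₀ +ᵛ scale c p

      t-fixed : conj t ≡ t
      t-fixed = trans (conj-+ c₀ (conj c₀)) (trans (cong (conj c₀ +_) (conj-conj c₀)) (+-comm _ _))

      conj-c : conj c ≡ - h y₀ y₀ * inv t t≢0 * conj c₀
      conj-c = trans (conj-* _ c₀) (cong (_* conj c₀) (trans (conj-* _ _)
        (cong₂ _*_ (trans (conj-neg _) (cong -_ (h-fixed y₀))) (conj-inv t≢0 t-fixed))))

      y′p : h y′ p ≡ 1#
      y′p = begin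
        h y′ p                ≡⟨ trans (h-+ˡ y₀ _ p) (cong (h y₀ p +_) (h-scaleˡ c p p)) ⟩
        h y₀ p + c * h p p    ≡⟨ cong₂ (λ a b → a + c * b) (y-dual zero zero) pp ⟩
        1# + c * 0#           ≡⟨ trans (cong (1# +_) (zeroʳ c)) (+-identityʳ 1#) ⟩
        1#                    ∎

      y′u : ∀ i → h y′ (u i) ≡ 0#
      y′u i = line-⊥ c (y-dual (suc i) zero) (pu i)

      y′y′ : h y′ y′ ≡ 0#
      y′y′ = begin
        h y′ y′    ≡⟨ h-line c y₀ p ⟩
        h y₀ y₀ + conj c * h y₀ p + c * h p y₀ + c * conj c * h p p
          ≡⟨ cong₂ (λ a b → h y₀ y₀ + conj c * a + c * b + c * conj c * h p p) (y-dual zero zero)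
               (trans (h-sym y₀ p) (trans (cong conj (y-dual zero zero)) (pow-1 q))) ⟩
        h y₀ y₀ + conj c * 1# + c * 1# + c * conj c * h p p
          ≡⟨ cong₂ _+_ (cong₂ (λ a b → h y₀ y₀ + a + b) (*-identityʳ _) (*-identityʳ _))
                       (trans (cong (c * conj c *_) pp) (zeroʳ _)) ⟩
        h y₀ y₀ + conj c + c + 0#
          ≡⟨ trans (+-identityʳ _) (cong (λ a → h y₀ y₀ + a + c) conj-c) ⟩
        h y₀ y₀ + - h y₀ y₀ * inv t t≢0 * conj c₀ + c
          ≡⟨ solve 4 (λ a i b b′ → a :+ :- a :* i :* b′ :+ :- a :* i :* b := a :+ :- a :* ((b :+ b′) :* i))
               refl (h y₀ y₀) (inv t t≢0) c₀ (conj c₀) ⟩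
        h y₀ y₀ + - h y₀ y₀ * (t * inv t t≢0)
          ≡⟨ cong (λ a → h y₀ y₀ + - h y₀ y₀ * a) (inv-r t t≢0) ⟩
        h y₀ y₀ + - h y₀ y₀ * 1#   ≡⟨ trans (cong (h y₀ y₀ +_) (*-identityʳ _)) (-‿inverseʳ _) ⟩
        0#         ∎

      up : ∀ i → h (u i) p ≡ 0#
      up i = ⊥-sym (pu i)

      fr′ : Frame (y′ ∷ u)
      fr′ = frame-extend fr y′ y′y′ y′u λ y′∈u → 0≢1 (trans (sym (span-⊥ y′∈u up)) y′p)

      found : (Σ V λ x → InSpan x (y′ ∷ u) × O x × (∀ y → InSpan y (y′ ∷ u) → O y → SamePoint x y)) →
        ∃ λ x → O x × h x x ≡ 0# × (∀ i → h x (u i) ≡ 0#) × h x p ≢ 0#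
      found (x , x∈ , Ox , _) = x , Ox , span-isotropic fr′ x∈ x∈ ,
        (λ i → span-⊥ x∈ λ j → isotropic fr′ j (suc i)) , xp
        where
        a : Fin (suc k) → Carrier
        a = proj₁ x∈
        -- Pairing with `p` reads off the coefficient of `y′`. If it vanished, `x` would be a point
        -- of `O` in the span of `u`.
        xp : h x p ≢ 0#
        xp eq = disjoint x Ox ((a ∘ suc) , λ i → trans (proj₂ x∈ i) (trans (cong (_+ lincomb (a ∘ suc) u i)
          (trans (cong (_* y′ i) a₀≡0) (zeroˡ _))) (+-identityˡ _)))
          where
          a₀≡0 : a zero ≡ 0#
          a₀≡0 = begin
            a zero                ≡⟨ trans (+-identityʳ _) (*-identityʳ _) ⟨
            a zero * 1# + 0#
              ≡⟨ cong₂ _+_ (cong (a zero *_) y′p) (trans (∑-cong k (λ j → trans (cong (a (suc j) *_) (up j)) (zeroʳ _))) (∑-0 k)) ⟨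
            ∑ (suc k) (λ j → a j * h ((y′ ∷ u) j) p)
              ≡⟨ h-lincombˡ a (y′ ∷ u) p ⟨
            h (lincomb a (y′ ∷ u)) p
              ≡⟨ h-congˡ p (proj₂ x∈) ⟨
            h x p                 ≡⟨ eq ⟩
            0#                    ∎

  -- `point-p` is the invariant that separates the blocks of the recursion. For isotropic vectors
  -- `nonorthogonal` is stronger than spanning distinct points, and it is what the Gram matrix
  -- needs.
  record Points {k} (u : Fin k → V) (p : V) (N : ℕ) : Set where
    field
      point          : Fin N → V
      point∈O        : ∀ i → O (point i)
      point-isotropic : ∀ i → h (point i) (point i) ≡ 0#
      point⊥u        : ∀ i j → h (point i) (u j) ≡ 0#
      point-p        : ∀ i → h (point i) p ≢ 0#
      nonorthogonal  : ∀ {i j} → i ≢ j → h (point i) (point j) ≢ 0#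

  -- For r isotropic and orthogonal to p ∷ u, the q² frames (r + c p) ∷ u have perpendicular
  -- spaces that meet O in disjoint sets apart from p: a common point is orthogonal to p.
  points : ∀ m {k} {u : Fin k → V} → m ℕ.+ suc k ≡ d → Frame u → Disjoint u →
    ∀ {p} → O p → h p p ≡ 0# → (∀ i → h p (u i) ≡ 0#) → Points u p (s ℕ.^ m)
  points zero eq fr disjoint {p} Op pp pu with secondPoint eq fr disjoint Op pp pu
  ... | x , Ox , xx , xu , xp = record
    { point = λ _ → x ; point∈O = λ _ → Ox ; point-isotropic = λ _ → xx ; point⊥u = λ _ → xu
    ; point-p = λ _ → xp ; nonorthogonal = λ { {zero} {zero} 0≢0 → contradiction refl 0≢0 } }
  points (suc m) {k} {u} eq fr disjoint {p} Op pp pu = extended (isotropic-extension frp room)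
    where
    frp : Frame (p ∷ u)
    frp = frame-extend fr p pp pu (disjoint p Op)
    2+k≤d : suc (suc k) ℕ.≤ d
    2+k≤d = subst (suc (suc k) ℕ.≤_) eq (s≤s (ℕ.m≤n+m (suc k) m))
    room : suc (suc k ℕ.+ suc k) ℕ.< d ℕ.+ d
    room = subst (ℕ._≤ d ℕ.+ d) (cong suc (ℕ.+-suc (suc k) (suc k))) (ℕ.+-mono-≤ 2+k≤d 2+k≤d)
    1<d : 1 ℕ.< d
    1<d = ℕ.≤-trans (s≤s (s≤s z≤n)) 2+k≤d

    extended : (∃ λ r → Frame (r ∷ (p ∷ u))) → Points u p (s ℕ.^ suc m)
    extended (r , frr) = record
      { point = λ i → P.point (c i) (t i)
      ; point∈O = λ i → P.point∈O (c i) (t i)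
      ; point-isotropic = λ i → P.point-isotropic (c i) (t i)
      ; point⊥u = λ i j → P.point⊥u (c i) (t i) (suc j)
      ; point-p = λ i → P.point-p (c i) (t i)
      ; nonorthogonal = λ {i} {j} → distinct i j
      }
      where
      g = covectors frr
      line : Carrier → V
      line c = r +ᵛ scale c p
      line-u : ∀ c i → h (line c) (u i) ≡ 0#
      line-u c i = line-⊥ c (isotropic frr zero (suc (suc i))) (pu i)
      line-p : ∀ c → h (line c) p ≡ 0#
      line-p c = line-⊥ c (isotropic frr zero (suc zero)) pp
      line-line : ∀ c → h (line c) (line c) ≡ 0#
      line-line c = line-⊥ c (⊥-sym (line-⊥ c (isotropic frr zero zero) (isotropic frr (suc zero) zero))) (⊥-sym (line-p c))

      dot-line : ∀ c {a b} → dot r a ≡ b → dot p a ≡ 0# → dot (line c) a ≡ b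
      dot-line c {a} {b} ra pa = begin
        dot (line c) a          ≡⟨ trans (dot-+ˡ r _ a) (cong (dot r a +_) (dot-scaleˡ c p a)) ⟩
        dot r a + c * dot p a   ≡⟨ cong₂ (λ x y → x + c * y) ra pa ⟩
        b + c * 0#              ≡⟨ trans (cong (b +_) (zeroʳ c)) (+-identityʳ b) ⟩
        b                       ∎

      frame : ∀ c → Frame (line c ∷ u)
      frame c = record
        -- The covector of `p` is dropped; the others vanish at `p`, so they do not see the shift by
        -- `scale c p`.
        { covectors = g zero ∷ λ i → g (suc (suc i))
        ; dual = λ { zero zero → dot-line c (dual frr zero zero) (dual frr (suc zero) zero)
                   ; zero (suc j) → dot-line c (dual frr zero (suc (suc j))) (dual frr (suc zero) (suc (suc j)))
                   ; (suc i) zero → dual frr (suc (suc i)) zero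
                   ; (suc i) (suc j) → dual frr (suc (suc i)) (suc (suc j)) }
        ; isotropic = ∷-isotropic fr (line c) (line-line c) (line-u c) }

      -- A point of `O` in this span is orthogonal to `p`, hence equal to `p`. The covector of `r`
      -- vanishes at `p`, so the coefficient of `line c` is 0 and the point lies in the span of `u`.
      disjoint′ : ∀ c → Disjoint (line c ∷ u)
      disjoint′ c x Ox x∈@(a , x≡) = disjoint x Ox ((a ∘ suc) , λ i → trans (x≡ i)
        (trans (cong (_+ lincomb (a ∘ suc) u i) (trans (cong (_* line c i) a₀≡0) (zeroˡ _))) (+-identityˡ _)))
        where
        x~p : SamePoint x p
        x~p = orthogonal⇒samePoint 1<d Ox (span-isotropic (frame c) x∈ x∈) Op pp
          (span-⊥ {v = line c ∷ u} x∈ λ { zero → line-p c ; (suc i) → ⊥-sym (pu i) })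
        a₀≡0 : a zero ≡ 0#
        a₀≡0 = *-cancel (proj₁ (proj₂ x~p)) (begin
          μ * a zero             ≡⟨ cong (μ *_) (dual-coefficient _ _ (dual (frame c)) a zero) ⟨
          μ * dot (lincomb a (line c ∷ u)) (g zero)
            ≡⟨ cong (μ *_) (dot-congˡ (g zero) x≡) ⟨
          μ * dot x (g zero)     ≡⟨ dot-scaleˡ μ x (g zero) ⟨
          dot (scale μ x) (g zero)   ≡⟨ dot-congˡ (g zero) (proj₂ (proj₂ x~p)) ⟨
          dot p (g zero)         ≡⟨ dual frr (suc zero) zero ⟩
          0#                     ∎)
          where μ = proj₁ x~p

      family : ∀ c → Points (line c ∷ u) p (s ℕ.^ m)
      family c = points m (trans (ℕ.+-suc m (suc k)) eq) (frame c) (disjoint′ c) Op pp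
        λ { zero → ⊥-sym (line-p c) ; (suc i) → pu i }
      module P c = Points (family c)

      c : Fin (s ℕ.* s ℕ.^ m) → Carrier
      c i = element (proj₁ (remQuot {s} (s ℕ.^ m) i))
      t : Fin (s ℕ.* s ℕ.^ m) → Fin (s ℕ.^ m)
      t i = proj₂ (remQuot {s} (s ℕ.^ m) i)

      -- `h (line c) x` is affine in `c` with slope `h p x`, so it has at most one zero.
      two-lines : ∀ {c c′ x} → h (line c) x ≡ 0# → h (line c′) x ≡ 0# → h p x ≢ 0# → c ≡ c′
      two-lines {c} {c′} {x} cx c′x px = -≡0 (*-cancel px (begin
        h p x * (c + - c′)      ≡⟨ solve 4 (λ p c d r → p :* (c :+ :- d) := (r :+ c :* p) :+ :- (r :+ d :* p)) refl (h p x) c c′ (h r x) ⟩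
        (h r x + c * h p x) + - (h r x + c′ * h p x)
          ≡⟨ cong₂ (λ a b → a + - b) (expand c) (expand c′) ⟨
        h (line c) x + - h (line c′) x   ≡⟨ cong₂ (λ a b → a + - b) cx c′x ⟩
        0# + - 0#               ≡⟨ -‿inverseʳ 0# ⟩
        0#                      ∎))
        where
        expand : ∀ c → h (line c) x ≡ h r x + c * h p x
        expand c = trans (h-+ˡ r _ x) (cong (h r x +_) (h-scaleˡ c p x))

      -- Within one block the induction applies. Across blocks, orthogonal points of `O` would
      -- coincide, and one point would be orthogonal to `line c` for two values of `c` without being
      -- orthogonal to `p`.
      distinct : ∀ i j → i ≢ j → h (P.point (c i) (t i)) (P.point (c j) (t j)) ≢ 0#
      distinct i j i≢j x⊥y with proj₁ (remQuot {s} (s ℕ.^ m) i) Fin.≟ proj₁ (remQuot {s} (s ℕ.^ m) j)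
      ... | yes same = P.nonorthogonal (c i) (λ t≡ → i≢j (begin
              i                                             ≡⟨ Fin.combine-remQuot {s} (s ℕ.^ m) i ⟨
              uncurry combine (remQuot {s} (s ℕ.^ m) i)     ≡⟨ cong₂ combine same t≡ ⟩
              uncurry combine (remQuot {s} (s ℕ.^ m) j)     ≡⟨ Fin.combine-remQuot {s} (s ℕ.^ m) j ⟩
              j                                             ∎))
            (subst (λ b → h (P.point (c i) (t i)) (P.point (element b) (t j)) ≡ 0#) (sym same) x⊥y)
      ... | no  differ = differ (element-injective (two-lines
              (⊥-sym (P.point⊥u (c i) (t i) zero))
              (⊥-sym (samePoint-⊥ (orthogonal⇒samePoint 1<d
                (P.point∈O (c j) (t j)) (P.point-isotropic (c j) (t j))
                (P.point∈O (c i) (t i)) (P.point-isotropic (c i) (t i)) (⊥-sym x⊥y))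
                (P.point⊥u (c j) (t j) zero)))
              (λ eq → P.point-p (c i) (t i) (⊥-sym eq))))

  manyPoints : 0 ℕ.< d → ∃ λ p → Points ∅ p (s ℕ.^ (d ℕ.∸ 1))
  manyPoints 0<d with ovoid-point d (ℕ.+-identityʳ d) emptyFrame
  ... | p , Op , pp , _ = p , points (d ℕ.∸ 1) (ℕ.m∸n+n≡m 0<d) emptyFrame
    (λ { x Ox (_ , x≡0) → proj₁ (proj₁ ovoid) x Ox x≡0 }) Op pp (λ ())

-- Comparison of the two bounds

module Growth where
  open +-*-Solver
  open ℕ.≤-Reasoning

  -- (1 + 1/x)^m ≤ 1/(1 − m/x), cleared of denominators, with j = x − m.
  bernoulli : ∀ x m j → m ℕ.+ j ≡ x → suc x ℕ.^ m ℕ.* j ℕ.≤ x ℕ.^ suc m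
  bernoulli x zero    j refl = ℕ.≤-reflexive (trans (ℕ.*-identityˡ j) (sym (ℕ.*-identityʳ j)))
  bernoulli x (suc m) j eq   = begin
    (suc x ℕ.* suc x ℕ.^ m) ℕ.* j    ≡⟨ solve 3 (λ y z j → (y :* z) :* j := z :* (y :* j)) refl (suc x) (suc x ℕ.^ m) j ⟩
    suc x ℕ.^ m ℕ.* (suc x ℕ.* j)
      -- From `j ≤ x` follows (x + 1) j ≤ x (j + 1), which trades one factor x + 1 for a factor x.
      ≤⟨ ℕ.*-monoʳ-≤ (suc x ℕ.^ m) (ℕ.+-mono-≤ (subst (j ℕ.≤_) eq (ℕ.m≤n+m j (suc m))) (ℕ.≤-refl {x ℕ.* j})) ⟩
    suc x ℕ.^ m ℕ.* (x ℕ.+ x ℕ.* j)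
      ≡⟨ solve 3 (λ z x j → z :* (x :+ x :* j) := x :* (z :* (con 1 :+ j))) refl (suc x ℕ.^ m) x j ⟩
    x ℕ.* (suc x ℕ.^ m ℕ.* suc j)    ≤⟨ ℕ.*-monoʳ-≤ x (bernoulli x m (suc j) (trans (ℕ.+-suc m j) eq)) ⟩
    x ℕ.* x ℕ.^ suc m                ∎

  -- For `m ≤ x / 2` the bound 1 / (1 - m/x) of `bernoulli` is at most 2.
  ^-doubling : ∀ x m .{{_ : ℕ.NonZero x}} → 2 ℕ.* m ℕ.≤ x → suc x ℕ.^ m ℕ.≤ 2 ℕ.* x ℕ.^ m
  ^-doubling x m 2m≤x = ℕ.*-cancelʳ-≤ (suc x ℕ.^ m) (2 ℕ.* x ℕ.^ m) x (begin
    suc x ℕ.^ m ℕ.* x              ≤⟨ ℕ.*-monoʳ-≤ (suc x ℕ.^ m) x≤2j ⟩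
    suc x ℕ.^ m ℕ.* (2 ℕ.* j)      ≡⟨ solve 2 (λ z j → z :* (con 2 :* j) := con 2 :* (z :* j)) refl (suc x ℕ.^ m) j ⟩
    2 ℕ.* (suc x ℕ.^ m ℕ.* j)      ≤⟨ ℕ.*-monoʳ-≤ 2 (bernoulli x m j m+j≡x) ⟩
    2 ℕ.* (x ℕ.* x ℕ.^ m)          ≡⟨ solve 2 (λ x y → con 2 :* (x :* y) := con 2 :* y :* x) refl x (x ℕ.^ m) ⟩
    2 ℕ.* x ℕ.^ m ℕ.* x            ∎)
    where
    j = x ℕ.∸ m
    m≤x : m ℕ.≤ x
    m≤x = ℕ.≤-trans (ℕ.m≤m+n m (m ℕ.+ 0)) 2m≤x
    m+j≡x : m ℕ.+ j ≡ x
    m+j≡x = ℕ.m+[n∸m]≡n m≤x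
    x≤2j : x ℕ.≤ 2 ℕ.* j
    x≤2j = ℕ.+-cancelˡ-≤ (2 ℕ.* m) x (2 ℕ.* j) (begin
      2 ℕ.* m ℕ.+ x          ≤⟨ ℕ.+-monoˡ-≤ x 2m≤x ⟩
      x ℕ.+ x                ≡⟨ cong₂ ℕ._+_ m+j≡x m+j≡x ⟨
      m ℕ.+ j ℕ.+ (m ℕ.+ j)  ≡⟨ solve 2 (λ m j → m :+ j :+ (m :+ j) := con 2 :* m :+ con 2 :* j) refl m j ⟩
      2 ℕ.* m ℕ.+ 2 ℕ.* j    ∎)

  double-^ : ∀ x m → (x ℕ.+ x) ℕ.^ m ≡ 2 ℕ.^ m ℕ.* x ℕ.^ m
  double-^ x zero    = refl
  double-^ x (suc m) = trans (cong ((x ℕ.+ x) ℕ.*_) (double-^ x m))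
    (solve 3 (λ x a b → (x :+ x) :* (a :* b) := (con 2 :* a) :* (x :* b)) refl x (2 ℕ.^ m) (x ℕ.^ m))

  -- Raising the rank by one at most doubles the power on the left and multiplies the right side by
  -- `Q ≥ 2`. The summand 2 survives doubling, and it makes the inequality the exact negation of
  -- `rank-bound`.
  exponential-wins : ∀ m Q x e .{{_ : ℕ.NonZero x}} → 2 ℕ.≤ Q → 2 ℕ.* m ℕ.≤ x → 2 ℕ.+ (x ℕ.+ x) ℕ.^ m ℕ.≤ Q ℕ.^ e →
    ∀ t → 2 ℕ.+ ((t ℕ.+ x) ℕ.+ (t ℕ.+ x)) ℕ.^ m ℕ.≤ Q ℕ.^ (t ℕ.+ e)
  exponential-wins m Q x e 2≤Q 2m≤x base zero    = base
  exponential-wins m Q x e 2≤Q 2m≤x base (suc t) = begin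
    2 ℕ.+ (suc y ℕ.+ suc y) ℕ.^ m            ≡⟨ cong (2 ℕ.+_) (double-^ (suc y) m) ⟩
    2 ℕ.+ 2 ℕ.^ m ℕ.* suc y ℕ.^ m            ≤⟨ ℕ.+-monoʳ-≤ 2 (ℕ.*-monoʳ-≤ (2 ℕ.^ m) (^-doubling y m {{y≢0}} 2m≤y)) ⟩
    2 ℕ.+ 2 ℕ.^ m ℕ.* (2 ℕ.* y ℕ.^ m)        ≡⟨ solve 2 (λ a b → con 2 :+ a :* (con 2 :* b) := con 2 :+ con 2 :* (a :* b)) refl (2 ℕ.^ m) (y ℕ.^ m) ⟩
    2 ℕ.+ 2 ℕ.* (2 ℕ.^ m ℕ.* y ℕ.^ m)        ≡⟨ cong (λ z → 2 ℕ.+ 2 ℕ.* z) (double-^ y m) ⟨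
    2 ℕ.+ 2 ℕ.* (y ℕ.+ y) ℕ.^ m              ≤⟨ ℕ.m≤n+m _ 2 ⟩
    2 ℕ.+ (2 ℕ.+ 2 ℕ.* (y ℕ.+ y) ℕ.^ m)      ≡⟨ solve 1 (λ z → con 2 :+ (con 2 :+ con 2 :* z) := con 2 :* (con 2 :+ z)) refl ((y ℕ.+ y) ℕ.^ m) ⟩
    2 ℕ.* (2 ℕ.+ (y ℕ.+ y) ℕ.^ m)            ≤⟨ ℕ.*-mono-≤ 2≤Q (exponential-wins m Q x e 2≤Q 2m≤x base t) ⟩
    Q ℕ.* Q ℕ.^ (t ℕ.+ e)                    ∎
    where
    y = t ℕ.+ x
    2m≤y : 2 ℕ.* m ℕ.≤ y
    2m≤y = ℕ.≤-trans 2m≤x (ℕ.m≤n+m x t)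
    y≢0 : ℕ.NonZero y
    y≢0 = ℕ.>-nonZero (ℕ.≤-trans (ℕ.>-nonZero⁻¹ x) (ℕ.m≤n+m x t))

  2m≤1+w : ∀ q′ → 1 ℕ.≤ q′ → ∀ m → suc q′ ℕ.^ 2 ≡ suc m → 2 ℕ.* m ℕ.≤ suc (q′ ℕ.* suc q′ ℕ.^ 2 ℕ.+ 2)
  2m≤1+w (suc r) _ m eq = begin
    2 ℕ.* m                   ≡⟨ cong (2 ℕ.*_) m≡ ⟩
    2 ℕ.* (3 ℕ.+ 4 ℕ.* r ℕ.+ r ℕ.* r)
                              -- The added term is the exact difference of the two sides as a
                              -- polynomial in `r = q − 2`; its coefficients are natural numbers.
                              ≤⟨ ℕ.m≤m+n _ (1 ℕ.+ 3 ℕ.* (r ℕ.* r) ℕ.+ r ℕ.* (r ℕ.* r)) ⟩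
    2 ℕ.* (3 ℕ.+ 4 ℕ.* r ℕ.+ r ℕ.* r) ℕ.+ (1 ℕ.+ 3 ℕ.* (r ℕ.* r) ℕ.+ r ℕ.* (r ℕ.* r))
      ≡⟨ solve 1 (λ r → con 2 :* (con 3 :+ con 4 :* r :+ r :* r) :+ (con 1 :+ con 3 :* (r :* r) :+ r :* (r :* r))
                   := con 1 :+ ((con 1 :+ r) :* ((con 2 :+ r) :* ((con 2 :+ r) :* con 1)) :+ con 2)) refl r ⟩
    suc (suc r ℕ.* suc (suc r) ℕ.^ 2 ℕ.+ 2)  ∎
    where
    m≡ : m ≡ 3 ℕ.+ 4 ℕ.* r ℕ.+ r ℕ.* r
    m≡ = ℕ.suc-injective (trans (sym eq) (solve 1 (λ r → (con 2 :+ r) :* ((con 2 :+ r) :* con 1) := con 4 :+ con 4 :* r :+ r :* r) refl r))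

  -- Here q = q′ + 1 and w = q³ − q² + 2, so w + 1 is the least admissible rank.  For q ≥ 3 use
  -- 2 (w + 1) ≤ q⁴ and 4 (q² − 1) + 1 ≤ 2 w; for q = 2 the claim reads 2 + 14³ ≤ 4⁶.
  threshold : ∀ q′ → 1 ℕ.≤ q′ → ∀ m → suc q′ ℕ.^ 2 ≡ suc m → let w = q′ ℕ.* suc q′ ℕ.^ 2 ℕ.+ 2 in
    2 ℕ.+ (suc w ℕ.+ suc w) ℕ.^ m ℕ.≤ (suc q′ ℕ.^ 2) ℕ.^ w
  threshold (suc zero)    _ 3 refl = ℕ.≤ᵇ⇒≤ 2746 4096 _
  threshold (suc (suc r)) _ m eq   = begin
    2 ℕ.+ (suc w ℕ.+ suc w) ℕ.^ m    ≤⟨ ℕ.+-monoʳ-≤ 2 (ℕ.^-monoˡ-≤ m 2+2w≤q⁴) ⟩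
    2 ℕ.+ (q ℕ.^ 4) ℕ.^ m            ≡⟨ cong (2 ℕ.+_) (ℕ.^-*-assoc q 4 m) ⟩
    2 ℕ.+ q ℕ.^ (4 ℕ.* m)            ≤⟨ ℕ.+-monoˡ-≤ (q ℕ.^ (4 ℕ.* m)) (ℕ.*-monoʳ-≤ 2 (ℕ.m^n>0 q (4 ℕ.* m))) ⟩
    2 ℕ.* q ℕ.^ (4 ℕ.* m) ℕ.+ q ℕ.^ (4 ℕ.* m)
                                     ≡⟨ solve 1 (λ z → con 2 :* z :+ z := con 3 :* z) refl (q ℕ.^ (4 ℕ.* m)) ⟩
    -- Absorbing the summand 2 costs a factor 3, which one factor `q` pays for. At `q = 2` the next
    -- step would fail too: 4 m + 1 = 13 and 2 w = 12.
    3 ℕ.* q ℕ.^ (4 ℕ.* m)            ≤⟨ ℕ.*-monoˡ-≤ (q ℕ.^ (4 ℕ.* m)) (ℕ.m≤m+n 3 r) ⟩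
    q ℕ.^ suc (4 ℕ.* m)              ≤⟨ ℕ.^-monoʳ-≤ q 1+4m≤2w ⟩
    q ℕ.^ (2 ℕ.* w)                  ≡⟨ ℕ.^-*-assoc q 2 w ⟨
    (q ℕ.^ 2) ℕ.^ w                  ∎
    where
    q w : ℕ
    q = suc (suc (suc r))
    w = suc (suc r) ℕ.* q ℕ.^ 2 ℕ.+ 2

    m≡ : m ≡ 8 ℕ.+ 6 ℕ.* r ℕ.+ r ℕ.* r
    m≡ = ℕ.suc-injective (trans (sym eq)
      (solve 1 (λ r → (con 3 :+ r) :* ((con 3 :+ r) :* con 1) := con 9 :+ con 6 :* r :+ r :* r) refl r))

    2+2w≤q⁴ : suc w ℕ.+ suc w ℕ.≤ q ℕ.^ 4
    2+2w≤q⁴ = subst (suc w ℕ.+ suc w ℕ.≤_)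
      (solve 1 (λ r → let q = con 3 :+ r
                          w = (con 2 :+ r) :* (q :* (q :* con 1)) :+ con 2
                      in (con 1 :+ w) :+ (con 1 :+ w) :+ (con 39 :+ con 66 :* r :+ con 38 :* (r :* r)
                           :+ con 10 :* (r :* (r :* r)) :+ r :* (r :* (r :* r)))
                         := q :* (q :* (q :* (q :* con 1)))) refl r)
      (ℕ.m≤m+n _ _)

    1+4m≤2w : suc (4 ℕ.* m) ℕ.≤ 2 ℕ.* w
    1+4m≤2w = subst₂ (λ a b → suc (4 ℕ.* a) ℕ.≤ b) (sym m≡)
      (solve 1 (λ r → con 1 :+ con 4 :* (con 8 :+ con 6 :* r :+ r :* r)
                        :+ (con 7 :+ con 18 :* r :+ con 12 :* (r :* r) :+ con 2 :* (r :* (r :* r)))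
                      := con 2 :* ((con 2 :+ r) :* ((con 3 :+ r) :* ((con 3 :+ r) :* con 1)) :+ con 2)) refl r)
      (ℕ.m≤m+n _ _)

  gram-rank<points : ∀ {q d m} → 1 ℕ.< q → q ℕ.^ 3 ℕ.∸ q ℕ.^ 2 ℕ.+ 2 ℕ.< d → q ℕ.^ 2 ≡ suc m →
    2 ℕ.+ (d ℕ.+ d) ℕ.^ m ℕ.≤ (q ℕ.^ 2) ℕ.^ (d ℕ.∸ 1)
  gram-rank<points {suc q′} {d} {m} (s≤s 1≤q′) w<d eq = subst (λ d → 2 ℕ.+ (d ℕ.+ d) ℕ.^ m ℕ.≤ (suc q′ ℕ.^ 2) ℕ.^ (d ℕ.∸ 1)) t+1+w≡d
    (subst (λ e → 2 ℕ.+ (t ℕ.+ suc w ℕ.+ (t ℕ.+ suc w)) ℕ.^ m ℕ.≤ (suc q′ ℕ.^ 2) ℕ.^ e) (sym (cong (ℕ._∸ 1) (ℕ.+-suc t w)))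
      (exponential-wins m (suc q′ ℕ.^ 2) (suc w) w 2≤q² (2m≤1+w q′ 1≤q′ m eq) (threshold q′ 1≤q′ m eq) t))
    where
    w t : ℕ
    w = q′ ℕ.* suc q′ ℕ.^ 2 ℕ.+ 2
    t = d ℕ.∸ suc w
    t+1+w≡d : t ℕ.+ suc w ≡ d
    -- `q ^ 3` unfolds to `q ^ 2` plus `q′` times `q ^ 2`, so the truncated subtraction cancels
    -- exactly.
    t+1+w≡d = ℕ.m∸n+n≡m (subst (λ z → z ℕ.+ 2 ℕ.< d) (ℕ.m+n∸m≡n (suc q′ ℕ.^ 2) (q′ ℕ.* suc q′ ℕ.^ 2)) w<d)
    2≤q² : 2 ℕ.≤ suc q′ ℕ.^ 2
    2≤q² = ℕ.≤-trans (s≤s 1≤q′) (ℕ.m≤m*n (suc q′) (suc q′ ℕ.^ 1) {{ℕ.m^n≢0 (suc q′) 1}})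

open import Data.Nat using (ℕ; _+_; _∸_; _^_; _<_)

theorem6p3 : (q d : ℕ) → IsPrimePower q → (q ^ 3) ∸ (q ^ 2) + 2 < d →
    (F : Field) → HasOrder F (q ^ 2) →
    (A : Hermitian.Matrix F q (d + d)) →
    Hermitian.IsHermitianMatrix F q A → Hermitian.IsNonDegenerate F q A →
    ¬ (Σ (Hermitian.Vec F q (d + d) → Set) λ O → Hermitian.IsOvoid F q d A O)
theorem6p3 q d primePower w<d F order A hermitian nondegenerate (O , ovoid) =
  ℕ.<⇒≱ (Growth.gram-rank<points 1<q w<d q²≡)
        -- Using the covectors `L (point j)` absorbs the conjugation of the second argument: the
        -- Gram matrix becomes a matrix of dot products, to which tensor powers apply.
        (rank-bound point (L ∘ point) q²≡
          (λ i → trans (sym (h≡dot _ _)) (point-isotropic i))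
          (λ i≢j eq → nonorthogonal i≢j (trans (h≡dot _ _) eq)))
  where
  open Ovoid F q primePower order d A hermitian nondegenerate O ovoid
  open RankBound F q (q ^ 2) order using (rank-bound)

  q²≡ : q ^ 2 ≡ suc (suc (q ^ 2 ∸ 2))
  q²≡ = sym (ℕ.m+[n∸m]≡n (ℕ.≤-trans 1<q (ℕ.m≤m*n q (q ^ 1) {{ℕ.m^n≢0 q 1 {{ℕ.>-nonZero (ℕ.<⇒≤ 1<q)}}}})))

  open Points (proj₂ (manyPoints (ℕ.≤-trans (s≤s z≤n) w<d)))
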